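{- Let $G$ be a finite simple graph with maximum degree at most $3$ and let $CG$ be its clawed graph, with $n=|E(CG)|$. Then $M_2(CG)\simeq S^{\frac{2}{3}n-1}$.
   Context: For a graph $G$ of maximum degree at most $3$, the clawed graph $CG$ is obtained by subdividing every edge of $G$ (replacing $\{u,v\}$ by a new vertex $w$ and edges $\{u,w\},\{w,v\}$) and then attaching new leaves (pendant edges to new vertices) to every original vertex $v\in V(G)$ so that every original vertex has degree exactly $3$. A $2$-matching of a graph is a set of edges such that every vertex has degree at most $2$ in it. The $2$-matching complex $M_2(G)$ is the simplicial complex whose vertices are the edges of $G$ and whose faces are the $2$-matchings of $G$. $\simeq$ denotes homotopy equivalence. -}

module Defs where

open import Data.Empty using (⊥-elim)
open import Data.Fin.Base using (Fin; zero; suc)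
open import Data.Fin.Properties using (+↔⊎; *↔×; 0↔⊥; inj⇒≟)
open import Data.Fin.Subset using (Subset; _∈_; _⊆_; _∩_; ⁅_⁆) renaming (∣_∣ to card; ⊥ to ∅)
open import Data.Fin.Subset.Properties
  using (∣⁅x⁆∣≡1; ∣⊥∣≡0; ∣p∩q∣≤∣p∣; p⊆q⇒∣p∣≤∣q∣; x∈p∩q⁺; x∈p∩q⁻)
open import Data.Nat.Base as ℕ using (ℕ; zero; suc; _∸_; z≤n; s≤s)
import Data.Nat.Properties as ℕ
open import Data.Product.Base using (Σ; ∃; ∃-syntax; _×_; _,_; proj₁; proj₂; swap)
import Data.Product.Function.Dependent.Propositional as Σ-Fun
open import Data.Product.Function.NonDependent.Propositional using (_×-↔_)
open import Data.Rational.Base as ℚ using (ℚ; 0ℚ; 1ℚ; ½)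
import Data.Rational.Properties as ℚ
open import Data.Rational.Solver using (module +-*-Solver)
open import Data.Sum.Base using (_⊎_; inj₁; inj₂)
open import Data.Sum.Function.Propositional using (_⊎-↔_)
open import Data.Vec.Base using (tabulate)
open import Data.Vec.Functional using (Vector; foldr; head; tail)
open import Function.Base using (_∘_)
open import Function.Bundles using (_↔_; Inverse; mk↔ₛ′)
open import Function.Construct.Composition using (_↔-∘_)
open import Function.Construct.Identity using (↔-id)
open import Function.Construct.Symmetry using (↔-sym)
open import Function.Properties.Inverse using (↔⇒↣)
open import Relation.Binary.Definitions using (DecidableEquality)
open import Relation.Binary.PropositionalEquality
open import Relation.Nullary using (¬_; Dec; does)
open import Relation.Nullary.Decidable using (_⊎-dec_)

Eventually : (ℕ → Set) → Set
Eventually P = ∃[ N ] ∀ n → N ℕ.≤ n → P n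

-- Reals are Cauchy sequences of rationals; real equality is the relation _≈_
-- below, not _≡_.
IsCauchy : (ℕ → ℚ) → Set
IsCauchy x = ∀ ε → 0ℚ ℚ.< ε →
  ∃[ N ] ∀ m n → N ℕ.≤ m → N ℕ.≤ n → ℚ.∣ x m ℚ.- x n ∣ ℚ.< ε

record ℝ : Set where
  constructor mkℝ
  field
    seq    : ℕ → ℚ
    cauchy : IsCauchy seq

open ℝ public

0<½ε : ∀ {ε} → 0ℚ ℚ.< ε → 0ℚ ℚ.< ½ ℚ.* ε
0<½ε {ε} 0<ε = subst (ℚ._< ½ ℚ.* ε) (ℚ.*-zeroʳ ½) (ℚ.*-monoʳ-<-pos ½ 0<ε)

½ε+½ε : ∀ ε → ½ ℚ.* ε ℚ.+ ½ ℚ.* ε ≡ ε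
½ε+½ε ε = trans (sym (ℚ.*-distribʳ-+ ε ½ ½)) (ℚ.*-identityˡ ε)

+-sub : ∀ a b c d → (a ℚ.+ b) ℚ.- (c ℚ.+ d) ≡ (a ℚ.- c) ℚ.+ (b ℚ.- d)
+-sub = solve 4 (λ a b c d → (a :+ b) :- (c :+ d) := (a :- c) :+ (b :- d)) refl
  where open +-*-Solver

*-sub : ∀ a b c d → a ℚ.* b ℚ.- c ℚ.* d ≡ a ℚ.* (b ℚ.- d) ℚ.+ d ℚ.* (a ℚ.- c)
*-sub = solve 4 (λ a b c d → a :* b :- c :* d := a :* (b :- d) :+ d :* (a :- c)) refl
  where open +-*-Solver

neg-sub : ∀ a b → (ℚ.- a) ℚ.- (ℚ.- b) ≡ ℚ.- (a ℚ.- b)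
neg-sub = solve 2 (λ a b → (:- a) :- (:- b) := :- (a :- b)) refl
  where open +-*-Solver

sub-add : ∀ a b → (a ℚ.- b) ℚ.+ b ≡ a
sub-add = solve 2 (λ a b → (a :- b) :+ b := a) refl
  where open +-*-Solver

flip-sub : ∀ a b → ℚ.- (a ℚ.- b) ≡ b ℚ.- a
flip-sub = solve 2 (λ a b → :- (a :- b) := b :- a) refl
  where open +-*-Solver

abs-sub : ∀ a b → ℚ.∣ a ∣ ℚ.- ℚ.∣ b ∣ ℚ.≤ ℚ.∣ a ℚ.- b ∣
abs-sub a b = begin
  ℚ.∣ a ∣ ℚ.- ℚ.∣ b ∣                          ≡⟨ cong (λ z → ℚ.∣ z ∣ ℚ.- ℚ.∣ b ∣) (sub-add a b) ⟨
  ℚ.∣ (a ℚ.- b) ℚ.+ b ∣ ℚ.- ℚ.∣ b ∣            ≤⟨ ℚ.+-monoˡ-≤ (ℚ.- ℚ.∣ b ∣) (ℚ.∣p+q∣≤∣p∣+∣q∣ (a ℚ.- b) b) ⟩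
  (ℚ.∣ a ℚ.- b ∣ ℚ.+ ℚ.∣ b ∣) ℚ.- ℚ.∣ b ∣      ≡⟨ solve 2 (λ p q → (p :+ q) :- q := p) refl ℚ.∣ a ℚ.- b ∣ ℚ.∣ b ∣ ⟩
  ℚ.∣ a ℚ.- b ∣                                ∎
  where open ℚ.≤-Reasoning
        open +-*-Solver

abs-abs-sub : ∀ a b → ℚ.∣ ℚ.∣ a ∣ ℚ.- ℚ.∣ b ∣ ∣ ℚ.≤ ℚ.∣ a ℚ.- b ∣
abs-abs-sub a b with ℚ.∣p∣≡p∨∣p∣≡-p (ℚ.∣ a ∣ ℚ.- ℚ.∣ b ∣)
... | inj₁ eq = subst (ℚ._≤ ℚ.∣ a ℚ.- b ∣) (sym eq) (abs-sub a b)
... | inj₂ eq = subst₂ ℚ._≤_ (sym (trans eq (flip-sub ℚ.∣ a ∣ ℚ.∣ b ∣)))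
                  (trans (sym (ℚ.∣-p∣≡∣p∣ (b ℚ.- a))) (cong ℚ.∣_∣ (flip-sub b a)))
                  (abs-sub b a)

-- The bound is valid from some index on, which suffices for products.
cauchy⇒bounded : ∀ x → IsCauchy x →
  ∃[ b ] ℚ.Positive b × Eventually (λ n → ℚ.∣ x n ∣ ℚ.≤ b)
cauchy⇒bounded x cx with cx 1ℚ (ℚ.positive⁻¹ 1ℚ)
... | N , close = 1ℚ ℚ.+ ℚ.∣ x N ∣ , pos , N , bound
  where
  open ℚ.≤-Reasoning
  pos : ℚ.Positive (1ℚ ℚ.+ ℚ.∣ x N ∣)
  pos = ℚ.positive (subst (ℚ._< 1ℚ ℚ.+ ℚ.∣ x N ∣) (ℚ.+-identityʳ 0ℚ)
          (ℚ.+-mono-<-≤ (ℚ.positive⁻¹ 1ℚ) (ℚ.0≤∣p∣ (x N))))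
  bound : ∀ n → N ℕ.≤ n → ℚ.∣ x n ∣ ℚ.≤ 1ℚ ℚ.+ ℚ.∣ x N ∣
  bound n N≤n = begin
    ℚ.∣ x n ∣                          ≡⟨ cong ℚ.∣_∣ (sub-add (x n) (x N)) ⟨
    ℚ.∣ (x n ℚ.- x N) ℚ.+ x N ∣        ≤⟨ ℚ.∣p+q∣≤∣p∣+∣q∣ (x n ℚ.- x N) (x N) ⟩
    ℚ.∣ x n ℚ.- x N ∣ ℚ.+ ℚ.∣ x N ∣    ≤⟨ ℚ.+-monoˡ-≤ ℚ.∣ x N ∣ (ℚ.<⇒≤ (close n N N≤n ℕ.≤-refl)) ⟩
    1ℚ ℚ.+ ℚ.∣ x N ∣                   ∎

ε/b : ∀ ε b → .{{ℚ.Positive b}} → 0ℚ ℚ.< ε → ∃[ δ ] 0ℚ ℚ.< δ × b ℚ.* δ ≡ ε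
ε/b ε b 0<ε = 1/b ℚ.* ε , 0<δ , eq
  where
  instance b≢0 = ℚ.pos⇒nonZero b
  1/b = ℚ.1/ b
  instance 1/b>0 = ℚ.1/pos⇒pos b
  0<δ : 0ℚ ℚ.< 1/b ℚ.* ε
  0<δ = subst (ℚ._< 1/b ℚ.* ε) (ℚ.*-zeroʳ 1/b) (ℚ.*-monoʳ-<-pos 1/b 0<ε)
  eq : b ℚ.* (1/b ℚ.* ε) ≡ ε
  eq = trans (sym (ℚ.*-assoc b 1/b ε))
         (trans (cong (ℚ._* ε) (ℚ.*-inverseʳ b)) (ℚ.*-identityˡ ε))

abs-*-< : ∀ a b c δ → .{{ℚ.Positive b}} → ℚ.∣ a ∣ ℚ.≤ b → ℚ.∣ c ∣ ℚ.< δ →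
          ℚ.∣ a ℚ.* c ∣ ℚ.< b ℚ.* δ
abs-*-< a b c δ a≤b c<δ = begin-strict
  ℚ.∣ a ℚ.* c ∣        ≡⟨ ℚ.∣p*q∣≡∣p∣*∣q∣ a c ⟩
  ℚ.∣ a ∣ ℚ.* ℚ.∣ c ∣  ≤⟨ ℚ.*-monoʳ-≤-nonNeg ℚ.∣ c ∣ {{ℚ.∣-∣-nonNeg c}} a≤b ⟩
  b ℚ.* ℚ.∣ c ∣        <⟨ ℚ.*-monoʳ-<-pos b c<δ ⟩
  b ℚ.* δ              ∎
  where open ℚ.≤-Reasoning

⊔-≤ˡ : ∀ a b {n} → a ℕ.⊔ b ℕ.≤ n → a ℕ.≤ n
⊔-≤ˡ a b = ℕ.≤-trans (ℕ.m≤m⊔n a b)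
⊔-≤ʳ : ∀ a b {n} → a ℕ.⊔ b ℕ.≤ n → b ℕ.≤ n
⊔-≤ʳ a b = ℕ.≤-trans (ℕ.m≤n⊔m a b)

fromℚ : ℚ → ℝ
fromℚ q = mkℝ (λ _ → q) λ ε 0<ε →
  0 , λ _ _ _ _ → subst (λ z → ℚ.∣ z ∣ ℚ.< ε) (sym (ℚ.+-inverseʳ q)) 0<ε

0ℝ 1ℝ : ℝ
0ℝ = fromℚ 0ℚ
1ℝ = fromℚ 1ℚ

infixl 6 _+_ _-_
infixl 7 _*_
infix  8 -_
infix  4 _≈_ _<_ _≤_

_+_ : ℝ → ℝ → ℝ
mkℝ x cx + mkℝ y cy = mkℝ (λ n → x n ℚ.+ y n) λ ε 0<ε →
  let N₁ , close₁ = cx (½ ℚ.* ε) (0<½ε 0<ε)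
      N₂ , close₂ = cy (½ ℚ.* ε) (0<½ε 0<ε)
      open ℚ.≤-Reasoning
  in N₁ ℕ.⊔ N₂ , λ m n ≤m ≤n → begin-strict
    ℚ.∣ (x m ℚ.+ y m) ℚ.- (x n ℚ.+ y n) ∣          ≡⟨ cong ℚ.∣_∣ (+-sub (x m) (y m) (x n) (y n)) ⟩
    ℚ.∣ (x m ℚ.- x n) ℚ.+ (y m ℚ.- y n) ∣          ≤⟨ ℚ.∣p+q∣≤∣p∣+∣q∣ (x m ℚ.- x n) (y m ℚ.- y n) ⟩
    ℚ.∣ x m ℚ.- x n ∣ ℚ.+ ℚ.∣ y m ℚ.- y n ∣        <⟨ ℚ.+-mono-< (close₁ m n (⊔-≤ˡ N₁ N₂ ≤m) (⊔-≤ˡ N₁ N₂ ≤n))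
                                                                 (close₂ m n (⊔-≤ʳ N₁ N₂ ≤m) (⊔-≤ʳ N₁ N₂ ≤n)) ⟩
    ½ ℚ.* ε ℚ.+ ½ ℚ.* ε                            ≡⟨ ½ε+½ε ε ⟩
    ε                                              ∎

-_ : ℝ → ℝ
- mkℝ x cx = mkℝ (λ n → ℚ.- x n) λ ε 0<ε →
  let N , close = cx ε 0<ε
  in N , λ m n ≤m ≤n →
    subst (ℚ._< ε)
      (sym (trans (cong ℚ.∣_∣ (neg-sub (x m) (x n))) (ℚ.∣-p∣≡∣p∣ (x m ℚ.- x n))))
      (close m n ≤m ≤n)

_-_ : ℝ → ℝ → ℝ
x - y = x + (- y)

_*_ : ℝ → ℝ → ℝ
mkℝ x cx * mkℝ y cy = mkℝ (λ n → x n ℚ.* y n) λ ε 0<ε →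
  let a , a>0 , N₁ , x≤a = cauchy⇒bounded x cx
      b , b>0 , N₂ , y≤b = cauchy⇒bounded y cy
      δ₁ , 0<δ₁ , aδ₁ = ε/b (½ ℚ.* ε) a {{a>0}} (0<½ε 0<ε)
      δ₂ , 0<δ₂ , bδ₂ = ε/b (½ ℚ.* ε) b {{b>0}} (0<½ε 0<ε)
      N₃ , close₁ = cy δ₁ 0<δ₁
      N₄ , close₂ = cx δ₂ 0<δ₂
      M₁ = N₁ ℕ.⊔ N₃
      M₂ = N₂ ℕ.⊔ N₄
      open ℚ.≤-Reasoning
  in M₁ ℕ.⊔ M₂ , λ m n ≤m ≤n →
    let ≤m₁ = ⊔-≤ˡ M₁ M₂ ≤m
        ≤m₂ = ⊔-≤ʳ M₁ M₂ ≤m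
        ≤n₁ = ⊔-≤ˡ M₁ M₂ ≤n
        ≤n₂ = ⊔-≤ʳ M₁ M₂ ≤n
    in begin-strict
    ℚ.∣ x m ℚ.* y m ℚ.- x n ℚ.* y n ∣
      ≡⟨ cong ℚ.∣_∣ (*-sub (x m) (y m) (x n) (y n)) ⟩
    ℚ.∣ x m ℚ.* (y m ℚ.- y n) ℚ.+ y n ℚ.* (x m ℚ.- x n) ∣
      ≤⟨ ℚ.∣p+q∣≤∣p∣+∣q∣ (x m ℚ.* (y m ℚ.- y n)) (y n ℚ.* (x m ℚ.- x n)) ⟩
    ℚ.∣ x m ℚ.* (y m ℚ.- y n) ∣ ℚ.+ ℚ.∣ y n ℚ.* (x m ℚ.- x n) ∣
      <⟨ ℚ.+-mono-<
           (abs-*-< (x m) a (y m ℚ.- y n) δ₁ {{a>0}} (x≤a m (⊔-≤ˡ N₁ N₃ ≤m₁))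
             (close₁ m n (⊔-≤ʳ N₁ N₃ ≤m₁) (⊔-≤ʳ N₁ N₃ ≤n₁)))
           (abs-*-< (y n) b (x m ℚ.- x n) δ₂ {{b>0}} (y≤b n (⊔-≤ˡ N₂ N₄ ≤n₂))
             (close₂ m n (⊔-≤ʳ N₂ N₄ ≤m₂) (⊔-≤ʳ N₂ N₄ ≤n₂))) ⟩
    a ℚ.* δ₁ ℚ.+ b ℚ.* δ₂
      ≡⟨ cong₂ ℚ._+_ aδ₁ bδ₂ ⟩
    ½ ℚ.* ε ℚ.+ ½ ℚ.* ε
      ≡⟨ ½ε+½ε ε ⟩
    ε ∎

∣_∣ : ℝ → ℝ
∣ mkℝ x cx ∣ = mkℝ (λ n → ℚ.∣ x n ∣) λ ε 0<ε →
  let N , close = cx ε 0<ε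
  in N , λ m n ≤m ≤n → ℚ.≤-<-trans (abs-abs-sub (x m) (x n)) (close m n ≤m ≤n)

_≈_ : ℝ → ℝ → Set
x ≈ y = ∀ ε → 0ℚ ℚ.< ε → Eventually λ n → ℚ.∣ seq x n ℚ.- seq y n ∣ ℚ.< ε

_<_ : ℝ → ℝ → Set
x < y = ∃[ ε ] 0ℚ ℚ.< ε × Eventually λ n → seq x n ℚ.+ ε ℚ.< seq y n

_≤_ : ℝ → ℝ → Set
x ≤ y = ¬ (y < x)

∑ : ∀ {n} → Vector ℝ n → ℝ
∑ = foldr _+_ 0ℝ

Space : ℕ → Set₁
Space n = Vector ℝ n → Set

Point : ∀ {n} → Space n → Set
Point X = ∃ X

-- Points are compared by coordinates only; membership proofs play no role.
_≋_ : ∀ {n} {X : Space n} → Point X → Point X → Set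
(x , _) ≋ (y , _) = ∀ i → x i ≈ y i

-- The open ball of radius r around x in the sup metric, which induces the
-- usual topology of ℝⁿ.
_∈Ball⟨_,_⟩ : ∀ {n} {X : Space n} → Point X → Point X → ℝ → Set
(y , _) ∈Ball⟨ (x , _) , r ⟩ = ∀ i → ∣ x i - y i ∣ < r

-- A continuous f automatically respects _≋_: equal points lie in every ball
-- around each other.
Continuous : ∀ {m n} {X : Space m} {Y : Space n} → (Point X → Point Y) → Set
Continuous {X = X} {Y} f =
  ∀ x ε → 0ℝ < ε → ∃[ δ ] 0ℝ < δ ×
  (∀ x′ → _∈Ball⟨_,_⟩ {X = X} x′ x δ → _∈Ball⟨_,_⟩ {X = Y} (f x′) (f x) ε)

-- [0,1] × X, with the [0,1]-coordinate first.
Cylinder : ∀ {n} → Space n → Space (suc n)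
Cylinder X p = 0ℝ ≤ head p × head p ≤ 1ℝ × X (tail p)

time : ∀ {n} {X : Space n} → Point (Cylinder X) → ℝ
time (p , _) = head p

base : ∀ {n} {X : Space n} → Point (Cylinder X) → Point X
base (p , _ , _ , tail∈X) = tail p , tail∈X

record Homotopic {m n} {X : Space m} {Y : Space n} (f g : Point X → Point Y) : Set where
  field
    H            : Point (Cylinder X) → Point Y
    H-continuous : Continuous {X = Cylinder X} {Y} H
    H-start      : ∀ p → time {X = X} p ≈ 0ℝ → _≋_ {X = Y} (H p) (f (base p))
    H-end        : ∀ p → time {X = X} p ≈ 1ℝ → _≋_ {X = Y} (H p) (g (base p))

infix 3 _≃_

record _≃_ {m n} (X : Space m) (Y : Space n) : Set where
  field
    to              : Point X → Point Y
    from            : Point Y → Point X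
    to-continuous   : Continuous {X = X} {Y} to
    from-continuous : Continuous {X = Y} {X} from
    from∘to         : Homotopic {X = X} {X} (from ∘ to) (λ x → x)
    to∘from         : Homotopic {X = Y} {Y} (to ∘ from) (λ y → y)

-- The unit sphere of ℝᵈ, i.e. the (d-1)-dimensional sphere; empty for d = 0.
S^[_-1] : ∀ d → Space d
S^[ d -1] x = ∑ (λ i → x i * x i) ≈ 1ℝ

record SimplicialComplex (n : ℕ) : Set₁ where
  field
    Face        : Subset n → Set
    ∅-face      : Face ∅
    vertex-face : ∀ i → Face ⁅ i ⁆
    down-closed : ∀ {σ τ} → σ ⊆ τ → Face τ → Face σ

-- Geometric realization in barycentric coordinates.  Usually one asks that
-- {i | 0 < t i} be a face; as positivity of reals is not decidable, this is
-- expressed by asking that all (decidable) subsets of it be faces.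
realization : ∀ {n} → SimplicialComplex n → Space n
realization K t =
  (∀ i → 0ℝ ≤ t i) ×
  ∑ t ≈ 1ℝ ×
  (∀ σ → (∀ {i} → i ∈ σ → 0ℝ < t i) → Face σ)
  where open SimplicialComplex K

record Finite (A : Set) : Set where
  field
    size : ℕ
    enum : A ↔ Fin size

  index : A → Fin size
  index = Inverse.to enum

  element : Fin size → A
  element = Inverse.from enum

  _≟_ : DecidableEquality A
  _≟_ = inj⇒≟ (↔⇒↣ enum)

-- The order of the two ends of an edge carries no information.
record Graph : Set₁ where
  field
    V E      : Set
    V-finite : Finite V
    E-finite : Finite E
    ends     : E → V × V
    loopless : ∀ e → proj₁ (ends e) ≢ proj₂ (ends e)
    simple   : ∀ e f → ends e ≡ ends f ⊎ ends e ≡ swap (ends f) → e ≡ f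

  Incident : V → E → Set
  Incident v e = v ≡ proj₁ (ends e) ⊎ v ≡ proj₂ (ends e)

  incident? : ∀ v e → Dec (Incident v e)
  incident? v e = (v ≟ proj₁ (ends e)) ⊎-dec (v ≟ proj₂ (ends e))
    where open Finite V-finite

  ∣E∣ : ℕ
  ∣E∣ = Finite.size E-finite

  edgesAt : V → Subset ∣E∣
  edgesAt v = tabulate λ i → does (incident? v (Finite.element E-finite i))

  degree : V → ℕ
  degree v = card (edgesAt v)

MaxDegreeAtMost : ℕ → Graph → Set
MaxDegreeAtMost k G = ∀ v → degree v ℕ.≤ k
  where open Graph G

module _ (G : Graph) where
  open Graph G

  Is2Matching : Subset ∣E∣ → Set
  Is2Matching σ = ∀ v → card (σ ∩ edgesAt v) ℕ.≤ 2

  M₂ : SimplicialComplex ∣E∣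
  M₂ = record
    { Face        = Is2Matching
    ; ∅-face      = λ v → ℕ.≤-trans (∣p∩q∣≤∣p∣ ∅ (edgesAt v))
                      (subst (ℕ._≤ 2) (sym (∣⊥∣≡0 ∣E∣)) z≤n)
    ; vertex-face = λ i v → ℕ.≤-trans (∣p∩q∣≤∣p∣ ⁅ i ⁆ (edgesAt v))
                      (subst (ℕ._≤ 2) (sym (∣⁅x⁆∣≡1 i)) (s≤s z≤n))
    ; down-closed = λ {σ} {τ} σ⊆τ τ-face v → ℕ.≤-trans
                      (p⊆q⇒∣p∣≤∣q∣ λ x∈ →
                        let x∈σ , x∈v = x∈p∩q⁻ σ (edgesAt v) x∈
                        in x∈p∩q⁺ (σ⊆τ x∈σ , x∈v))
                      (τ-face v)
    }

Fin-finite : ∀ n → Finite (Fin n)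
Fin-finite n = record { size = n ; enum = ↔-id _ }

⊎-finite : ∀ {A B} → Finite A → Finite B → Finite (A ⊎ B)
⊎-finite a b = record
  { size = Finite.size a ℕ.+ Finite.size b
  ; enum = ↔-sym +↔⊎ ↔-∘ (Finite.enum a ⊎-↔ Finite.enum b)
  }

×-finite : ∀ {A B} → Finite A → Finite B → Finite (A × B)
×-finite a b = record
  { size = Finite.size a ℕ.* Finite.size b
  ; enum = ↔-sym *↔× ↔-∘ (Finite.enum a ×-↔ Finite.enum b)
  }

ΣFin-suc : ∀ {n} (f : Fin (suc n) → ℕ) →
           Σ (Fin (suc n)) (Fin ∘ f) ↔ (Fin (f zero) ⊎ Σ (Fin n) (Fin ∘ f ∘ suc))
ΣFin-suc f = mk↔ₛ′
  (λ { (zero , j) → inj₁ j ; (suc i , j) → inj₂ (i , j) })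
  (λ { (inj₁ j) → zero , j ; (inj₂ (i , j)) → suc i , j })
  (λ { (inj₁ _) → refl ; (inj₂ _) → refl })
  (λ { (zero , _) → refl ; (suc _ , _) → refl })

ΣFin-finite : ∀ n (f : Fin n → ℕ) → Finite (Σ (Fin n) (Fin ∘ f))
ΣFin-finite zero    f = record
  { size = 0 ; enum = mk↔ₛ′ (λ ()) (λ ()) (λ ()) (λ ()) }
ΣFin-finite (suc n) f =
  let rest = ⊎-finite (Fin-finite (f zero)) (ΣFin-finite n (f ∘ suc))
  in record { size = Finite.size rest ; enum = Finite.enum rest ↔-∘ ΣFin-suc f }

Σ-finite : ∀ {A} → Finite A → (f : A → ℕ) → Finite (Σ A (Fin ∘ f))
Σ-finite {A} a f = record
  { size = Finite.size fin
  ; enum = Finite.enum fin ↔-∘ ↔-sym (Σ-Fun.cong (↔-sym enum) (↔-id _))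
  }
  where
  open Finite a
  fin : Finite (Σ (Fin size) (Fin ∘ f ∘ element))
  fin = ΣFin-finite size (f ∘ element)

module Clawed (G : Graph) where
  open Graph G

  -- Subdividing edges leaves the degrees of the original vertices unchanged,
  -- so 3 ∸ degree v leaves at v make its degree 3 whenever degree v ≤ 3.
  Leaf : Set
  Leaf = Σ V λ v → Fin (3 ∸ degree v)

  CV CE : Set
  CV = V ⊎ (E ⊎ Leaf)
  CE = (E × Fin 2) ⊎ Leaf

  pattern original v = inj₁ v
  pattern midpoint e = inj₂ (inj₁ e)
  pattern leaf l     = inj₂ (inj₂ l)

  pattern half e s  = inj₁ (e , s)
  pattern pendant l = inj₂ l

  end : E → Fin 2 → V
  end e zero       = proj₁ (ends e)
  end e (suc zero) = proj₂ (ends e)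

  cends : CE → CV × CV
  cends (half e s)  = original (end e s) , midpoint e
  cends (pendant l) = original (proj₁ l) , leaf l

  private
    end-injective : ∀ e s t → end e s ≡ end e t → s ≡ t
    end-injective e zero       zero       _  = refl
    end-injective e zero       (suc zero) eq = ⊥-elim (loopless e eq)
    end-injective e (suc zero) zero       eq = ⊥-elim (loopless e (sym eq))
    end-injective e (suc zero) (suc zero) _  = refl

    original-injective : ∀ {v w} → _≡_ {A = CV} (original v) (original w) → v ≡ w
    original-injective refl = refl

    midpoint-injective : ∀ {e f} → _≡_ {A = CV} (midpoint e) (midpoint f) → e ≡ f
    midpoint-injective refl = refl

    leaf-injective : ∀ {k l} → _≡_ {A = CV} (leaf k) (leaf l) → k ≡ l
    leaf-injective refl = refl

  cloopless : ∀ e → proj₁ (cends e) ≢ proj₂ (cends e)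
  cloopless (half _ _)  ()
  cloopless (pendant _) ()

  csimple : ∀ e f → cends e ≡ cends f ⊎ cends e ≡ swap (cends f) → e ≡ f
  csimple (half e s) (half f t) (inj₁ eq) with midpoint-injective (cong proj₂ eq)
  ... | refl = cong (λ s → half e s)
                 (end-injective e s t (original-injective (cong proj₁ eq)))
  csimple (half _ _)  (pendant _) (inj₁ eq) with () ← cong proj₂ eq
  csimple (pendant _) (half _ _)  (inj₁ eq) with () ← cong proj₂ eq
  csimple (pendant _) (pendant _) (inj₁ eq) =
    cong (λ l → pendant l) (leaf-injective (cong proj₂ eq))
  csimple (half _ _)  (half _ _)  (inj₂ eq) with () ← cong proj₁ eq
  csimple (half _ _)  (pendant _) (inj₂ eq) with () ← cong proj₁ eq
  csimple (pendant _) (half _ _)  (inj₂ eq) with () ← cong proj₁ eq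
  csimple (pendant _) (pendant _) (inj₂ eq) with () ← cong proj₁ eq

  Leaf-finite : Finite Leaf
  Leaf-finite = Σ-finite V-finite (λ v → 3 ∸ degree v)

  clawedGraph : Graph
  clawedGraph = record
    { V        = CV
    ; E        = CE
    ; V-finite = ⊎-finite V-finite (⊎-finite E-finite Leaf-finite)
    ; E-finite = ⊎-finite (×-finite E-finite (Fin-finite 2)) Leaf-finite
    ; ends     = cends
    ; loopless = cloopless
    ; simple   = csimple
    }

open Clawed public using (clawedGraph)

{-# OPTIONS --safe #-}

-- In CG every original vertex v carries a claw of exactly three edges, the claws partition
-- E(CG), and a set of edges is a 2-matching iff it contains no full claw.  So M₂(CG) is a join
-- of |V| triangle boundaries, and barycentric coordinates amount to a family of triples t_v ≥ 0
-- with minimum 0 and total sum 1.  Subtracting the last entry of each triple from the other two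
-- flattens it to a point of the plane, with inverse (a, b) ↦ (a, b, 0) - min(a, b, 0).  Followed
-- by radial projection this is a homeomorphism onto the unit sphere of the product of |V| planes.
-- Radial projection needs inverse square roots of Cauchy reals, which Newton's division-free
-- iteration g ↦ g (1 + (1 - a g²)/2) provides on any interval [1/E , E].

module Submission where

open import Defs using (Graph; MaxDegreeAtMost; clawedGraph; M₂; realization; _≃_; S^[_-1])
open import Data.Nat using (_*_)
open import Data.Product using (∃-syntax; _×_)
open import Relation.Binary.PropositionalEquality using (_≡_)

open import Data.Bool.Base using (true)
open import Data.Empty using (⊥-elim)
open import Data.Fin.Base using (Fin; zero; suc; combine; remQuot; inject₁; punchOut)
open import Data.Fin.Patterns using (0F; 1F; 2F)
open import Data.Fin.Permutation using (↔⇒≡)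
open import Data.Fin.Properties
  using (+↔⊎; *↔×; injective⇒≤; punchOut-injective; ¬∀⟶∃¬; suc-injective; remQuot-combine; combine-remQuot)
open import Data.Fin.Subset using (Subset; _∈_; _∩_; inside; outside) renaming (∣_∣ to card)
open import Data.Fin.Subset.Properties using (_∈?_; x∈p∩q⁺; x∈p∩q⁻)
open import Data.Integer.Base as ℤ using (-[1+_]) renaming (+_ to pos)
import Data.Integer.Properties as ℤ
open import Data.Nat.Base as ℕ using (ℕ; zero; suc; _∸_; z≤n; s≤s)
import Data.Nat.Properties as ℕ
open import Data.Product.Base using (Σ; _,_; proj₁; proj₂)
import Data.Product.Function.Dependent.Propositional as Σ-Fun
open import Data.Product.Function.NonDependent.Propositional using (_×-↔_)
open import Data.Rational.Base as ℚ
  using (ℚ; 0ℚ; 1ℚ; ½; mkℚ; _+_; _-_; -_; _≤_; _<_; ∣_∣; _⊓_; _⊔_; toℚᵘ) renaming (_*_ to _·_)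
import Data.Rational.Properties as ℚ
open import Data.Rational.Solver using (module +-*-Solver)
import Data.Rational.Unnormalised.Base as ℚᵘ
import Data.Rational.Unnormalised.Properties as ℚᵘ
open import Data.Sum.Base using (_⊎_; inj₁; inj₂)
open import Data.Vec.Base using (_∷_; here; there)
open import Data.Vec.Functional using (Vector; foldr; tail)
open import Data.Vec.Properties using (lookup∘tabulate; lookup⇒[]=; []=⇒lookup)
open import Function.Base using (_∘_)
open import Function.Bundles using (_↔_; Inverse; mk↔ₛ′)
open import Function.Construct.Composition using (_↔-∘_)
open import Function.Construct.Identity using (↔-id)
open import Function.Construct.Symmetry using (↔-sym)
open import Relation.Binary.Bundles using (Setoid)
open import Relation.Binary.PropositionalEquality
  using (_≢_; refl; sym; trans; cong; cong₂; subst; subst₂; module ≡-Reasoning)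
import Relation.Binary.Reasoning.Setoid as SetoidReasoning
open import Relation.Binary.Structures using (IsEquivalence)
open import Relation.Nullary using (¬_; Dec; yes; no; does; contradiction)
open import Relation.Nullary.Decidable using (dec-true; toWitness)
open import Defs using
  ( sub-add; flip-sub; +-sub; *-sub; ½ε+½ε; 0<½ε; ε/b; abs-*-<; ⊔-≤ˡ; ⊔-≤ʳ
  ; Eventually; ℝ; mkℝ; seq; cauchy; cauchy⇒bounded; fromℚ; 0ℝ; 1ℝ; _≈_; ∑
  ; Space; Point; Continuous; Cylinder; base; Homotopic
  ; SimplicialComplex; Finite; module Clawed)
  renaming (_+_ to _+ᴿ_; _-_ to _-ᴿ_; _*_ to _·ᴿ_; _≤_ to _≤ᴿ_; _<_ to _<ᴿ_)

-- The sign of a Cauchy real cannot be decided, so there is no case split on which entry of a triple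
-- is least, and inverting a real takes explicit bounds away from zero. Algebraic identities are
-- therefore proved term by term on the rational sequences; `_≅_` enters where an equation holds
-- only in the limit, such as membership in the sphere or in the polytope. Both directions normalise
-- with the same routine: the gauge `size` is inverted as the inverse square root of its square.
-- Clamping the argument to an interval makes this routine total, so both maps are formulas on the
-- whole ambient space, and their continuity is proved there before restricting to the subspaces.
-- The interval comes from comparing the gauge with the Euclidean norm. A graph without vertices is
-- covered by the same argument: both spaces are then empty, and the successors in the constants
-- keep `E` at least 1.

open +-*-Solver using (solve; con; _:+_; _:*_; _:-_; _:=_; :-_)

-- Order on the rationals

≤-from-diff : ∀ a b → 0ℚ ≤ b - a → a ≤ b
≤-from-diff a b p = subst₂ _≤_ (ℚ.+-identityˡ a) (sub-add b a) (ℚ.+-monoˡ-≤ a p)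

0≤-diff : ∀ a b → a ≤ b → 0ℚ ≤ b - a
0≤-diff a b p = subst (_≤ b - a) (ℚ.+-inverseʳ a) (ℚ.+-monoˡ-≤ (- a) p)

0≤+ : ∀ {a b} → 0ℚ ≤ a → 0ℚ ≤ b → 0ℚ ≤ a + b
0≤+ {a} {b} p q = subst (_≤ a + b) (ℚ.+-identityʳ 0ℚ) (ℚ.+-mono-≤ p q)

·-monoˡ : ∀ {a b} c → 0ℚ ≤ c → a ≤ b → a · c ≤ b · c
·-monoˡ c 0≤c = ℚ.*-monoʳ-≤-nonNeg c {{ℚ.nonNegative 0≤c}}

·-monoʳ : ∀ {a b} c → 0ℚ ≤ c → a ≤ b → c · a ≤ c · b
·-monoʳ c 0≤c = ℚ.*-monoˡ-≤-nonNeg c {{ℚ.nonNegative 0≤c}}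

0≤· : ∀ {a b} → 0ℚ ≤ a → 0ℚ ≤ b → 0ℚ ≤ a · b
0≤· {a} {b} p q = subst (_≤ a · b) (ℚ.*-zeroˡ b) (·-monoˡ b q p)

0<· : ∀ {a b} → 0ℚ < a → 0ℚ < b → 0ℚ < a · b
0<· {a} {b} p q = subst (_< a · b) (ℚ.*-zeroʳ a) (ℚ.*-monoʳ-<-pos a {{ℚ.positive p}} q)

·-mono : ∀ {a b c d} → 0ℚ ≤ c → 0ℚ ≤ b → a ≤ b → c ≤ d → a · c ≤ b · d
·-mono {a} {b} {c} {d} 0≤c 0≤b a≤b c≤d = ℚ.≤-trans (·-monoˡ c 0≤c a≤b) (·-monoʳ b 0≤b c≤d)

≤+ˡ : ∀ {a b} → 0ℚ ≤ b → a ≤ b + a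
≤+ˡ {a} {b} p = subst (_≤ b + a) (ℚ.+-identityˡ a) (ℚ.+-monoˡ-≤ a p)

≤+ʳ : ∀ {a b} → 0ℚ ≤ b → a ≤ a + b
≤+ʳ {a} {b} p = subst (_≤ a + b) (ℚ.+-identityʳ a) (ℚ.+-monoʳ-≤ a p)

0≤square : ∀ a → 0ℚ ≤ a · a
0≤square a with ℚ.≤-total 0ℚ a
... | inj₁ p = 0≤· p p
... | inj₂ p = subst (0ℚ ≤_) (solve 1 (λ a → (:- a) :* (:- a) := a :* a) refl a)
                 (0≤· {a = - a} (ℚ.neg-antimono-≤ p) (ℚ.neg-antimono-≤ p))

0<½ : 0ℚ < ½
0<½ = ℚ.positive⁻¹ ½

0≤1 : 0ℚ ≤ 1ℚ
0≤1 = ℚ.nonNegative⁻¹ 1ℚ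

0<1 : 0ℚ < 1ℚ
0<1 = ℚ.positive⁻¹ 1ℚ

-- Absolute values

a≤∣a∣ : ∀ a → a ≤ ∣ a ∣
a≤∣a∣ a with ℚ.≤-total 0ℚ a
... | inj₁ p = ℚ.≤-reflexive (sym (ℚ.0≤p⇒∣p∣≡p p))
... | inj₂ p = ℚ.≤-trans p (ℚ.0≤∣p∣ a)

-a≤∣a∣ : ∀ a → - a ≤ ∣ a ∣
-a≤∣a∣ a = subst (- a ≤_) (ℚ.∣-p∣≡∣p∣ a) (a≤∣a∣ (- a))

abs<⁺ : ∀ {a ε} → a < ε → - a < ε → ∣ a ∣ < ε
abs<⁺ {a} p q with ℚ.∣p∣≡p∨∣p∣≡-p a
... | inj₁ eq = subst (_< _) (sym eq) p
... | inj₂ eq = subst (_< _) (sym eq) q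

abs≤⁺ : ∀ {a ε} → a ≤ ε → - a ≤ ε → ∣ a ∣ ≤ ε
abs≤⁺ {a} p q with ℚ.∣p∣≡p∨∣p∣≡-p a
... | inj₁ eq = subst (_≤ _) (sym eq) p
... | inj₂ eq = subst (_≤ _) (sym eq) q

abs-sub<⁺ : ∀ a b ε → a < b + ε → b < a + ε → ∣ a - b ∣ < ε
abs-sub<⁺ a b ε p q = abs<⁺ (shift a b p) (subst (_< ε) (sym (flip-sub a b)) (shift b a q))
  where
  shift : ∀ x y → x < y + ε → x - y < ε
  shift x y r = subst (x - y <_) (solve 2 (λ y e → (y :+ e) :- y := e) refl y ε)
                  (ℚ.+-monoˡ-< (- y) r)

abs-sub<⁻ : ∀ a b {ε} → ∣ a - b ∣ < ε → a < b + ε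
abs-sub<⁻ a b {ε} p = subst₂ _<_ (sub-add a b) (ℚ.+-comm ε b)
  (ℚ.+-monoˡ-< b (ℚ.≤-<-trans (a≤∣a∣ (a - b)) p))

abs-sub-comm : ∀ a b → ∣ a - b ∣ ≡ ∣ b - a ∣
abs-sub-comm a b = trans (sym (ℚ.∣-p∣≡∣p∣ (a - b))) (cong ∣_∣ (flip-sub a b))

abs-sub<⁻′ : ∀ a b {ε} → ∣ a - b ∣ < ε → b < a + ε
abs-sub<⁻′ a b p = abs-sub<⁻ b a (subst (_< _) (abs-sub-comm a b) p)

abs-square : ∀ a → ∣ a ∣ · ∣ a ∣ ≡ a · a
abs-square a with ℚ.∣p∣≡p∨∣p∣≡-p a
... | inj₁ eq = cong₂ _·_ eq eq
... | inj₂ eq = trans (cong₂ _·_ eq eq) (solve 1 (λ a → (:- a) :* (:- a) := a :* a) refl a)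

square-cancel-≤ : ∀ {a b} → 0ℚ ≤ b → a · a ≤ b · b → ∣ a ∣ ≤ b
square-cancel-≤ {a} {b} 0≤b a²≤b² with ∣ a ∣ ℚ.≤? b
... | yes p = p
... | no ¬p = contradiction (ℚ.≤-<-trans a²≤b² (begin-strict
  b · b          ≤⟨ ·-monoʳ b 0≤b (ℚ.<⇒≤ b<a) ⟩
  b · ∣ a ∣      <⟨ ℚ.*-monoˡ-<-pos ∣ a ∣ {{ℚ.positive (ℚ.≤-<-trans 0≤b b<a)}} b<a ⟩
  ∣ a ∣ · ∣ a ∣  ≡⟨ abs-square a ⟩
  a · a          ∎)) (ℚ.<-irrefl refl)
  where open ℚ.≤-Reasoning
        b<a = ℚ.≰⇒> ¬p

-- Minimum is 1-Lipschitz for the sup metric: whichever argument attains the minimum on the right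
-- also bounds the one on the left.
⊓-close : ∀ a b a′ b′ {ε} → ∣ a - a′ ∣ < ε → ∣ b - b′ ∣ < ε → ∣ (a ⊓ b) - (a′ ⊓ b′) ∣ < ε
⊓-close a b a′ b′ {ε} p q = abs-sub<⁺ (a ⊓ b) (a′ ⊓ b′) ε
  (bound a b a′ b′ (abs-sub<⁻ a a′ p) (abs-sub<⁻ b b′ q))
  (bound a′ b′ a b (abs-sub<⁻′ a a′ p) (abs-sub<⁻′ b b′ q))
  where
  bound : ∀ x y x′ y′ → x < x′ + ε → y < y′ + ε → x ⊓ y < (x′ ⊓ y′) + ε
  bound x y x′ y′ r s with ℚ.⊓-sel x′ y′
  ... | inj₁ eq rewrite eq = ℚ.≤-<-trans (ℚ.p⊓q≤p x y) r
  ... | inj₂ eq rewrite eq = ℚ.≤-<-trans (ℚ.p⊓q≤q x y) s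

⊔-close : ∀ a b a′ b′ {ε} → ∣ a - a′ ∣ < ε → ∣ b - b′ ∣ < ε → ∣ (a ⊔ b) - (a′ ⊔ b′) ∣ < ε
⊔-close a b a′ b′ {ε} p q = abs-sub<⁺ (a ⊔ b) (a′ ⊔ b′) ε
  (bound a b a′ b′ (abs-sub<⁻ a a′ p) (abs-sub<⁻ b b′ q))
  (bound a′ b′ a b (abs-sub<⁻′ a a′ p) (abs-sub<⁻′ b b′ q))
  where
  bound : ∀ x y x′ y′ → x < x′ + ε → y < y′ + ε → x ⊔ y < (x′ ⊔ y′) + ε
  bound x y x′ y′ r s with ℚ.⊔-sel x y
  ... | inj₁ eq rewrite eq = ℚ.<-≤-trans r (ℚ.+-monoˡ-≤ ε (ℚ.p≤p⊔q x′ y′))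
  ... | inj₂ eq rewrite eq = ℚ.<-≤-trans s (ℚ.+-monoˡ-≤ ε (ℚ.p≤q⊔p x′ y′))

abs-triangle< : ∀ a b c {ε} → ∣ a - b ∣ < ½ · ε → ∣ b - c ∣ < ½ · ε → ∣ a - c ∣ < ε
abs-triangle< a b c {ε} p q = begin-strict
  ∣ a - c ∣              ≡⟨ cong ∣_∣ (solve 3 (λ a b c → a :- c := (a :- b) :+ (b :- c)) refl a b c) ⟩
  ∣ (a - b) + (b - c) ∣  ≤⟨ ℚ.∣p+q∣≤∣p∣+∣q∣ (a - b) (b - c) ⟩
  ∣ a - b ∣ + ∣ b - c ∣  <⟨ ℚ.+-mono-< p q ⟩
  ½ · ε + ½ · ε          ≡⟨ ½ε+½ε ε ⟩
  ε                      ∎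
  where open ℚ.≤-Reasoning

-- Finite sums

-- Built by repeated addition rather than as a fraction, so that inductions over finite sums involve
-- no normalisation.
ν : ℕ → ℚ
ν zero    = 0ℚ
ν (suc n) = 1ℚ + ν n

0≤ν : ∀ n → 0ℚ ≤ ν n
0≤ν zero    = ℚ.≤-refl
0≤ν (suc n) = 0≤+ 0≤1 (0≤ν n)

ν-mono : ∀ {m n} → m ℕ.≤ n → ν m ≤ ν n
ν-mono {n = n} ℕ.z≤n = 0≤ν n
ν-mono (ℕ.s≤s m≤n)   = ℚ.+-monoʳ-≤ 1ℚ (ν-mono m≤n)

ν≤ν-suc : ∀ n → ν n ≤ ν (suc n)
ν≤ν-suc n = ν-mono (ℕ.n≤1+n n)

toℚᵘ-ν : ∀ n → toℚᵘ (ν n) ℚᵘ.≃ ℚᵘ.mkℚᵘ (pos n) 0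
toℚᵘ-ν zero    = ℚᵘ.≃-refl
toℚᵘ-ν (suc n) = ℚᵘ.≃-trans (ℚ.toℚᵘ-homo-+ 1ℚ (ν n))
  (ℚᵘ.≃-trans (ℚᵘ.+-congʳ ℚᵘ.1ℚᵘ (toℚᵘ-ν n))
    (ℚᵘ.*≡* (cong (λ z → (pos 1 ℤ.+ z) ℤ.* pos 1) (ℤ.*-identityʳ (pos n)))))

-- The denominator of `q` serves as `n`: the product is then the numerator, a positive integer.
archimedean : ∀ q → 0ℚ < q → ∃[ n ] 1ℚ ≤ ν n · q
archimedean q@(mkℚ (pos zero) _ _)  0<q = contradiction refl
  (ℚ.<⇒≢ {0ℚ} {0ℚ} (subst (0ℚ <_) (ℚ.↥p≡0⇒p≡0 q refl) 0<q))
archimedean (mkℚ -[1+ _ ] _ _) (ℚ.*<* ())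
archimedean q@(mkℚ (pos (suc a)) d _) _ = suc d , ℚ.toℚᵘ-cancel-≤
  (ℚᵘ.≤-respʳ-≃ (ℚᵘ.≃-sym (ℚᵘ.≃-trans (ℚ.toℚᵘ-homo-* (ν (suc d)) q) (ℚᵘ.*-congʳ (toℚᵘ-ν (suc d)))))
    (ℚᵘ.*≤* (subst₂ ℤ._≤_ (sym (ℤ.*-identityˡ (pos (1 ℕ.* suc d))))
        (sym (ℤ.*-identityʳ (pos (suc d) ℤ.* pos (suc a))))
      (ℤ.+≤+ (subst (ℕ._≤ suc d ℕ.* suc a) (sym (ℕ.*-identityˡ (suc d))) (ℕ.m≤m*n (suc d) (suc a)))))))

sum : ∀ {k} → Vector ℚ k → ℚ
sum = foldr _+_ 0ℚ

sum-cong : ∀ {k} {f g : Vector ℚ k} → (∀ i → f i ≡ g i) → sum f ≡ sum g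
sum-cong {zero}  eq = refl
sum-cong {suc k} eq = cong₂ _+_ (eq zero) (sum-cong (λ i → eq (suc i)))

sum-· : ∀ {k} (f : Vector ℚ k) c → sum (λ i → f i · c) ≡ sum f · c
sum-· {zero}  f c = sym (ℚ.*-zeroˡ c)
sum-· {suc k} f c = trans (cong (λ z → f zero · c + z) (sum-· (λ i → f (suc i)) c))
  (sym (ℚ.*-distribʳ-+ c (f zero) (sum (λ i → f (suc i)))))

0≤sum : ∀ {k} {f : Vector ℚ k} → (∀ i → 0ℚ ≤ f i) → 0ℚ ≤ sum f
0≤sum {zero}  p = ℚ.≤-refl
0≤sum {suc k} p = 0≤+ (p zero) (0≤sum (λ i → p (suc i)))

term≤sum : ∀ {k} {f : Vector ℚ k} → (∀ i → 0ℚ ≤ f i) → ∀ i → f i ≤ sum f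
term≤sum p zero    = ≤+ʳ (0≤sum (λ i → p (suc i)))
term≤sum p (suc i) = ℚ.≤-trans (term≤sum (λ i → p (suc i)) i) (≤+ˡ (p zero))

sum≤ : ∀ {k} {f : Vector ℚ k} {B} → (∀ i → f i ≤ B) → sum f ≤ ν k · B
sum≤ {zero}  {B = B} p = ℚ.≤-reflexive (sym (ℚ.*-zeroˡ B))
sum≤ {suc k} {f} {B} p = begin
  f zero + sum (λ i → f (suc i))  ≤⟨ ℚ.+-mono-≤ (p zero) (sum≤ (λ i → p (suc i))) ⟩
  B + ν k · B                     ≡⟨ cong (_+ ν k · B) (ℚ.*-identityˡ B) ⟨
  1ℚ · B + ν k · B                ≡⟨ ℚ.*-distribʳ-+ B 1ℚ (ν k) ⟨
  (1ℚ + ν k) · B                  ∎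
  where open ℚ.≤-Reasoning

-- Inverse square roots on [κ , 1/κ]

module Newton (E κ : ℚ) (0<κ : 0ℚ < κ) (κ≤1 : κ ≤ 1ℚ) (1≤E : 1ℚ ≤ E) (Eκ≡1 : E · κ ≡ 1ℚ) where

  0≤κ : 0ℚ ≤ κ
  0≤κ = ℚ.<⇒≤ 0<κ

  κ≤E : κ ≤ E
  κ≤E = ℚ.≤-trans κ≤1 1≤E

  Bounded : ℚ → Set
  Bounded a = κ ≤ a × a ≤ E

  -- The lower bound arrives in the division-free form `1ℚ ≤ E · a`; multiplying it by `κ`, the
  -- reciprocal of `E`, brings it to the interval.
  bounded : ∀ a → 1ℚ ≤ E · a × a ≤ E → Bounded a
  bounded a (1≤Ea , a≤E) = κ≤a , a≤E
    where
    open ℚ.≤-Reasoning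
    κ≤a : κ ≤ a
    κ≤a = begin
      κ            ≡⟨ ℚ.*-identityʳ κ ⟨
      κ · 1ℚ       ≤⟨ ·-monoʳ κ 0≤κ 1≤Ea ⟩
      κ · (E · a)  ≡⟨ solve 3 (λ κ E a → κ :* (E :* a) := (E :* κ) :* a) refl κ E a ⟩
      E · κ · a    ≡⟨ cong (_· a) Eκ≡1 ⟩
      1ℚ · a       ≡⟨ ℚ.*-identityˡ a ⟩
      a            ∎

  -- Makes the iteration converge for every argument, so that the inverse square root is a total
  -- function of a real.
  clamp : ℚ → ℚ
  clamp a = κ ⊔ (a ⊓ E)

  clamp-bounded : ∀ a → Bounded (clamp a)
  clamp-bounded a = ℚ.p≤p⊔q κ (a ⊓ E) , ℚ.⊔-lub κ≤E (ℚ.p⊓q≤q a E)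

  clamp-id : ∀ {a} → Bounded a → clamp a ≡ a
  clamp-id (κ≤a , a≤E) = trans (cong (κ ⊔_) (ℚ.p≤q⇒p⊓q≡p a≤E)) (ℚ.p≤q⇒p⊔q≡q κ≤a)

  clamp-close : ∀ a b {ε} → ∣ a - b ∣ < ε → ∣ clamp a - clamp b ∣ < ε
  clamp-close a b {ε} p = ⊔-close κ (a ⊓ E) κ (b ⊓ E) (self κ) (⊓-close a E b E p (self E))
    where
    self : ∀ c → ∣ c - c ∣ < ε
    self c = subst (λ z → ∣ z ∣ < ε) (sym (ℚ.+-inverseʳ c)) (ℚ.≤-<-trans (ℚ.0≤∣p∣ (a - b)) p)

  -- Newton's method for the root of g ↦ 1/g² - a. The starting value lies below the root for every
  -- `a` in the interval, because a κ² ≤ E κ² = κ ≤ 1.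
  newton : ℕ → ℚ → ℚ
  newton zero    a = κ
  newton (suc n) a = newton n a · (1ℚ + ½ · (1ℚ - a · (newton n a · newton n a)))

  error : ℕ → ℚ → ℚ
  error n a = 1ℚ - a · (newton n a · newton n a)

  -- With e the old error, the new value of a g² is (1 - e)(1 + e/2)². The terms linear in e cancel,
  -- and e²(3 + e)/4 remains, which lies between 0 and e² as soon as e lies in [0,1].
  error-suc : ∀ n a → error (suc n) a ≡
              ½ · ½ · (error n a · error n a · (1ℚ + 1ℚ + 1ℚ + error n a))
  error-suc n a = trans (rearrange a (newton n a)) (cubic (a · (newton n a · newton n a)))
    where
    rearrange : ∀ a g → let w = 1ℚ + ½ · (1ℚ - a · (g · g)) in
                1ℚ - a · ((g · w) · (g · w)) ≡ 1ℚ - (a · (g · g)) · (w · w)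
    rearrange a g = cong (λ z → 1ℚ - z)
      (solve 3 (λ a g w → a :* ((g :* w) :* (g :* w)) := (a :* (g :* g)) :* (w :* w)) refl a g _)
    cubic : ∀ u → let w = 1ℚ + ½ · (1ℚ - u) ; e = 1ℚ - u in
            1ℚ - u · (w · w) ≡ ½ · ½ · (e · e · (1ℚ + 1ℚ + 1ℚ + e))
    cubic = solve 1 (λ u → let 1′ = con 1ℚ ; ½′ = con ½ ; e = 1′ :- u ; w = 1′ :+ ½′ :* e in
      1′ :- u :* (w :* w) := ½′ :* ½′ :* (e :* e :* (1′ :+ 1′ :+ 1′ :+ e))) refl

  -- A lower bound of a κ² over the whole interval, hence the distance from 1 that every error
  -- keeps.
  κ³ : ℚ
  κ³ = κ · (κ · κ)

  0<κ³ : 0ℚ < κ³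
  0<κ³ = 0<· 0<κ (0<· 0<κ 0<κ)

  module _ {a} (a-bounded : Bounded a) where

    0≤a : 0ℚ ≤ a
    0≤a = ℚ.≤-trans 0≤κ (proj₁ a-bounded)

    error≤1 : ∀ n → error n a ≤ 1ℚ
    error≤1 n = ≤-from-diff (error n a) 1ℚ
      (subst (0ℚ ≤_) (solve 1 (λ u → u := con 1ℚ :- (con 1ℚ :- u)) refl _)
        (0≤· 0≤a (0≤square (newton n a))))

    0≤error : ∀ n → 0ℚ ≤ error n a
    0≤error zero = 0≤-diff (a · (κ · κ)) 1ℚ (begin
      a · (κ · κ)  ≤⟨ ·-monoˡ (κ · κ) (0≤square κ) (proj₂ a-bounded) ⟩
      E · (κ · κ)  ≡⟨ ℚ.*-assoc E κ κ ⟨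
      E · κ · κ    ≡⟨ cong (_· κ) Eκ≡1 ⟩
      1ℚ · κ       ≡⟨ ℚ.*-identityˡ κ ⟩
      κ            ≤⟨ κ≤1 ⟩
      1ℚ           ∎)
      where open ℚ.≤-Reasoning
    0≤error (suc n) = subst (0ℚ ≤_) (sym (error-suc n a))
      (0≤· (0≤square ½) (0≤· (0≤square (error n a))
        (0≤+ {1ℚ + 1ℚ + 1ℚ} (ℚ.nonNegative⁻¹ (1ℚ + 1ℚ + 1ℚ)) (0≤error n))))

    error-suc≤ : ∀ n → error (suc n) a ≤ error n a · error n a
    error-suc≤ n = ≤-from-diff _ _ (subst (0ℚ ≤_)
      (trans (identity (error n a)) (cong (λ z → error n a · error n a - z) (sym (error-suc n a))))
      (0≤· (0≤square ½) (0≤· (0≤square (error n a)) (0≤-diff (error n a) 1ℚ (error≤1 n)))))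
      where
      identity : ∀ e → ½ · ½ · (e · e · (1ℚ - e)) ≡ e · e - ½ · ½ · (e · e · (1ℚ + 1ℚ + 1ℚ + e))
      identity = solve 1 (λ e → let 1′ = con 1ℚ ; ½′ = con ½ in
        ½′ :* ½′ :* (e :* e :* (1′ :- e)) :=
        e :* e :- ½′ :* ½′ :* (e :* e :* (1′ :+ 1′ :+ 1′ :+ e))) refl

    -- The iterates increase from `κ`, since a nonnegative error makes the correction factor at
    -- least 1.
    κ≤newton : ∀ n → κ ≤ newton n a
    κ≤newton zero    = ℚ.≤-refl
    κ≤newton (suc n) = begin
      κ                                 ≤⟨ κ≤newton n ⟩
      newton n a                        ≡⟨ ℚ.*-identityʳ (newton n a) ⟨
      newton n a · 1ℚ                   ≤⟨ ·-monoʳ (newton n a) (ℚ.≤-trans 0≤κ (κ≤newton n))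
                                             (≤+ʳ (0≤· (ℚ.<⇒≤ 0<½) (0≤error n))) ⟩
      newton n a · (1ℚ + ½ · error n a) ∎
      where open ℚ.≤-Reasoning

    error≤1-κ³ : ∀ n → error n a ≤ 1ℚ - κ³
    error≤1-κ³ zero = ℚ.+-monoʳ-≤ 1ℚ (ℚ.neg-antimono-≤ (·-monoˡ (κ · κ) (0≤square κ) (proj₁ a-bounded)))
    error≤1-κ³ (suc n) = begin
      error (suc n) a        ≤⟨ error-suc≤ n ⟩
      error n a · error n a  ≤⟨ ·-monoʳ (error n a) (0≤error n) (error≤1 n) ⟩
      error n a · 1ℚ         ≡⟨ ℚ.*-identityʳ (error n a) ⟩
      error n a              ≤⟨ error≤1-κ³ n ⟩
      1ℚ - κ³                ∎
      where open ℚ.≤-Reasoning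

    -- Decay of order 1/n already gives a modulus of convergence, with no powers to estimate. In the
    -- step, one factor of e · e is absorbed by the induction hypothesis and the other by 1 + κ³,
    -- because (1 - κ³)(1 + κ³) ≤ 1.
    error-decay : ∀ n → error n a · (1ℚ + ν n · κ³) ≤ 1ℚ
    error-decay zero = subst (_≤ 1ℚ)
      (sym (trans (cong (error 0 a ·_) (trans (cong (1ℚ +_) (ℚ.*-zeroˡ κ³)) (ℚ.+-identityʳ 1ℚ)))
                  (ℚ.*-identityʳ (error 0 a))))
      (error≤1 0)
    error-decay (suc n) = begin
      error (suc n) a · (1ℚ + (1ℚ + ν n) · κ³)
        ≤⟨ ·-mono 0≤s (0≤square e) (error-suc≤ n) (growth (ν n) κ³ (0≤ν n) 0≤κ³) ⟩
      e · e · ((1ℚ + ν n · κ³) · (1ℚ + κ³))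
        ≡⟨ solve 3 (λ e s t → e :* e :* (s :* t) := (e :* s) :* (e :* t)) refl e (1ℚ + ν n · κ³) (1ℚ + κ³) ⟩
      (e · (1ℚ + ν n · κ³)) · (e · (1ℚ + κ³))
        ≤⟨ ·-mono (0≤· (0≤error n) (0≤+ 0≤1 0≤κ³)) 0≤1 (error-decay n) contraction ⟩
      1ℚ · 1ℚ
        ≡⟨⟩
      1ℚ ∎
      where
      open ℚ.≤-Reasoning
      e = error n a
      0≤κ³ = ℚ.<⇒≤ 0<κ³
      0≤s : 0ℚ ≤ 1ℚ + (1ℚ + ν n) · κ³
      0≤s = 0≤+ 0≤1 (0≤· (0≤ν (suc n)) 0≤κ³)
      growth : ∀ k c → 0ℚ ≤ k → 0ℚ ≤ c → 1ℚ + (1ℚ + k) · c ≤ (1ℚ + k · c) · (1ℚ + c)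
      growth k c 0≤k 0≤c = ≤-from-diff _ _ (subst (0ℚ ≤_)
        (solve 2 (λ k c → k :* (c :* c) :=
          (con 1ℚ :+ k :* c) :* (con 1ℚ :+ c) :- (con 1ℚ :+ (con 1ℚ :+ k) :* c)) refl k c)
        (0≤· 0≤k (0≤square c)))
      contraction : e · (1ℚ + κ³) ≤ 1ℚ
      contraction = ℚ.≤-trans (·-monoˡ (1ℚ + κ³) (0≤+ 0≤1 0≤κ³) (error≤1-κ³ n))
        (≤-from-diff _ _ (subst (0ℚ ≤_)
          (solve 1 (λ c → c :* c := con 1ℚ :- (con 1ℚ :- c) :* (con 1ℚ :+ c)) refl κ³) (0≤square κ³)))

  -- `N` is chosen with N κ³ ε ≥ 1. An error of at least ε at a later index would push the product
  -- in `error-decay` above 1.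
  error-small : ∀ ε → 0ℚ < ε → ∃[ N ] ∀ n a → N ℕ.≤ n → Bounded a → error n a < ε
  error-small ε 0<ε = N , small
    where
    N = proj₁ (archimedean (κ³ · ε) (0<· 0<κ³ 0<ε))
    1≤Nκ³ε = proj₂ (archimedean (κ³ · ε) (0<· 0<κ³ 0<ε))
    small : ∀ n a → N ℕ.≤ n → Bounded a → error n a < ε
    small n a N≤n ab with error n a ℚ.<? ε
    ... | yes p = p
    ... | no ¬p = contradiction (ℚ.<-≤-trans 1<ε[1+Nκ³] (ℚ.≤-trans
                    (·-mono (0≤+ 0≤1 (0≤· (0≤ν n) (ℚ.<⇒≤ 0<κ³))) (0≤error ab n) (ℚ.≮⇒≥ ¬p) ℚ.≤-refl)
                    (error-decay ab n))) (ℚ.<-irrefl refl)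
      where
      open ℚ.≤-Reasoning
      1<ε[1+Nκ³] : 1ℚ < ε · (1ℚ + ν n · κ³)
      1<ε[1+Nκ³] = begin-strict
        1ℚ                      ≡⟨ ℚ.+-identityˡ 1ℚ ⟨
        0ℚ + 1ℚ                 <⟨ ℚ.+-monoˡ-< 1ℚ 0<ε ⟩
        ε + 1ℚ                  ≤⟨ ℚ.+-monoʳ-≤ ε 1≤Nκ³ε ⟩
        ε + ν N · (κ³ · ε)      ≤⟨ ℚ.+-monoʳ-≤ ε (·-monoˡ (κ³ · ε) (ℚ.<⇒≤ (0<· 0<κ³ 0<ε)) (ν-mono N≤n)) ⟩
        ε + ν n · (κ³ · ε)      ≡⟨ solve 3 (λ ε k c → ε :+ k :* (c :* ε) := ε :* (con 1ℚ :+ k :* c)) refl ε (ν n) κ³ ⟩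
        ε · (1ℚ + ν n · κ³)     ∎

  -- A single estimate for convergence (two indices) and continuity (two arguments). It rests on a(g
  -- + h)(g - h) = (f - e) + (b - a)h². On the left a(g + h) ≥ κ²; on the right κ h² ≤ b h² ≤ 1,
  -- which costs the third factor κ.
  newton-close : ∀ m n {a b} → Bounded a → Bounded b →
    κ³ · ∣ newton m a - newton n b ∣ ≤ error m a + error n b + ∣ a - b ∣
  newton-close m n {a} {b} ab bb = begin
    κ³ · ∣ g - h ∣
      ≡⟨ ℚ.*-assoc κ (κ · κ) ∣ g - h ∣ ⟩
    κ · (κ · κ · ∣ g - h ∣)
      ≤⟨ ·-monoʳ κ 0≤κ (·-monoˡ ∣ g - h ∣ (ℚ.0≤∣p∣ (g - h)) κκ≤) ⟩
    κ · (a · (g + h) · ∣ g - h ∣)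
      ≡⟨ cong (κ ·_) abs-eq ⟩
    κ · ∣ (f - e) + (b - a) · (h · h) ∣
      ≤⟨ ·-monoʳ κ 0≤κ (ℚ.≤-trans (ℚ.∣p+q∣≤∣p∣+∣q∣ (f - e) ((b - a) · (h · h)))
           (ℚ.+-mono-≤ |f-e|≤ (ℚ.≤-reflexive |d|))) ⟩
    κ · ((e + f) + ∣ a - b ∣ · (h · h))
      ≡⟨ solve 4 (λ κ s d q → κ :* (s :+ d :* q) := κ :* s :+ d :* (κ :* q)) refl κ (e + f) ∣ a - b ∣ (h · h) ⟩
    κ · (e + f) + ∣ a - b ∣ · (κ · (h · h))
      ≤⟨ ℚ.+-mono-≤ (·-monoˡ (e + f) (0≤+ 0≤e 0≤f) κ≤1) (·-monoʳ ∣ a - b ∣ (ℚ.0≤∣p∣ (a - b)) κhh≤1) ⟩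
    1ℚ · (e + f) + ∣ a - b ∣ · 1ℚ
      ≡⟨ cong₂ _+_ (ℚ.*-identityˡ (e + f)) (ℚ.*-identityʳ ∣ a - b ∣) ⟩
    e + f + ∣ a - b ∣ ∎
    where
    open ℚ.≤-Reasoning
    g = newton m a
    h = newton n b
    e = error m a
    f = error n b
    0≤e = 0≤error ab m
    0≤f = 0≤error bb n
    0≤g+h : 0ℚ ≤ g + h
    0≤g+h = 0≤+ (ℚ.≤-trans 0≤κ (κ≤newton ab m)) (ℚ.≤-trans 0≤κ (κ≤newton bb n))
    κκ≤ : κ · κ ≤ a · (g + h)
    κκ≤ = ·-mono 0≤κ (ℚ.≤-trans 0≤κ (proj₁ ab)) (proj₁ ab)
            (ℚ.≤-trans (κ≤newton ab m) (≤+ʳ (ℚ.≤-trans 0≤κ (κ≤newton bb n))))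
    abs-eq : a · (g + h) · ∣ g - h ∣ ≡ ∣ (f - e) + (b - a) · (h · h) ∣
    abs-eq = trans (cong (_· ∣ g - h ∣) (sym (ℚ.0≤p⇒∣p∣≡p (0≤· (ℚ.≤-trans 0≤κ (proj₁ ab)) 0≤g+h))))
      (trans (sym (ℚ.∣p*q∣≡∣p∣*∣q∣ (a · (g + h)) (g - h)))
        (cong ∣_∣ (solve 4 (λ a b g h → a :* (g :+ h) :* (g :- h) :=
           ((con 1ℚ :- b :* (h :* h)) :- (con 1ℚ :- a :* (g :* g))) :+ (b :- a) :* (h :* h)) refl a b g h)))
    |f-e|≤ : ∣ f - e ∣ ≤ e + f
    |f-e|≤ = subst (∣ f - e ∣ ≤_) (trans (cong₂ _+_ (ℚ.0≤p⇒∣p∣≡p 0≤f) (ℚ.0≤p⇒∣p∣≡p 0≤e)) (ℚ.+-comm f e))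
               (ℚ.∣p-q∣≤∣p∣+∣q∣ f e)
    |d| : ∣ (b - a) · (h · h) ∣ ≡ ∣ a - b ∣ · (h · h)
    |d| = trans (ℚ.∣p*q∣≡∣p∣*∣q∣ (b - a) (h · h))
            (cong₂ _·_ (abs-sub-comm b a) (ℚ.0≤p⇒∣p∣≡p (0≤square h)))
    κhh≤1 : κ · (h · h) ≤ 1ℚ
    κhh≤1 = ℚ.≤-trans (·-monoˡ (h · h) (0≤square h) (proj₁ bb))
      (≤-from-diff _ _ 0≤f)

  newton-close-< : ∀ ε → 0ℚ < ε → ∃[ τ ] 0ℚ < τ × ∃[ N ] ∀ m n a b → N ℕ.≤ m → N ℕ.≤ n →
    ∣ a - b ∣ < τ → ∣ newton m (clamp a) - newton n (clamp b) ∣ < ε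
  newton-close-< ε 0<ε = τ , 0<τ , N , close
    where
    -- A quarter, obtained by halving twice; only three terms have to fit: two errors and one
    -- distance.
    τ = ½ · (½ · (κ³ · ε))
    0<κ³ε = 0<· 0<κ³ 0<ε
    0<τ = 0<½ε (0<½ε 0<κ³ε)
    N = proj₁ (error-small τ 0<τ)
    close : ∀ m n a b → N ℕ.≤ m → N ℕ.≤ n → ∣ a - b ∣ < τ →
            ∣ newton m (clamp a) - newton n (clamp b) ∣ < ε
    close m n a b N≤m N≤n |a-b|<τ = ℚ.*-cancelˡ-<-nonNeg κ³ {{ℚ.nonNegative (ℚ.<⇒≤ 0<κ³)}} (begin-strict
      κ³ · ∣ newton m (clamp a) - newton n (clamp b) ∣
        ≤⟨ newton-close m n (clamp-bounded a) (clamp-bounded b) ⟩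
      error m (clamp a) + error n (clamp b) + ∣ clamp a - clamp b ∣
        <⟨ ℚ.+-mono-< (ℚ.+-mono-< (proj₂ (error-small τ 0<τ) m (clamp a) N≤m (clamp-bounded a))
                                  (proj₂ (error-small τ 0<τ) n (clamp b) N≤n (clamp-bounded b)))
                      (clamp-close a b |a-b|<τ) ⟩
      τ + τ + τ
        ≤⟨ ≤+ʳ (ℚ.<⇒≤ 0<τ) ⟩
      τ + τ + τ + τ
        ≡⟨ solve 1 (λ z → let t = con ½ :* (con ½ :* z) in t :+ t :+ t :+ t := z) refl (κ³ · ε) ⟩
      κ³ · ε ∎)
      where open ℚ.≤-Reasoning

-- Eventual properties

eventually : ∀ {P : ℕ → Set} → (∀ n → P n) → Eventually P
eventually p = 0 , λ n _ → p n

map-eventually : ∀ {P Q : ℕ → Set} → (∀ n → P n → Q n) → Eventually P → Eventually Q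
map-eventually f (N , p) = N , λ n N≤n → f n (p n N≤n)

zip-eventually : ∀ {P Q R : ℕ → Set} → (∀ n → P n → Q n → R n) →
                 Eventually P → Eventually Q → Eventually R
zip-eventually f (M , p) (N , q) = M ℕ.⊔ N , λ n ≤n →
  f n (p n (⊔-≤ˡ M N ≤n)) (q n (⊔-≤ʳ M N ≤n))

-- Equality and order of reals

-- Closeness with one rational radius. Asked for every positive radius it is `_≈_`, so a modulus of
-- continuity yields congruence as well.
Near : ℚ → ℝ → ℝ → Set
Near ε x y = Eventually λ n → ∣ seq x n - seq y n ∣ < ε

near-weaken : ∀ {δ ε} x y → δ ≤ ε → Near δ x y → Near ε x y
near-weaken x y δ≤ε = map-eventually λ _ p → ℚ.<-≤-trans p δ≤ε

≡⇒≈ : ∀ x y → (∀ n → seq x n ≡ seq y n) → x ≈ y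
≡⇒≈ x y eq ε 0<ε = eventually λ n →
  subst (λ z → ∣ z ∣ < ε) (sym (trans (cong (_- seq y n) (eq n)) (ℚ.+-inverseʳ (seq y n)))) 0<ε

-- A record, unlike _≈_ itself, lets unification recover its two sides.
infix 4 _≅_

record _≅_ (x y : ℝ) : Set where
  constructor wrap
  field unwrap : x ≈ y

open _≅_ public

≅-isEquivalence : IsEquivalence _≅_
≅-isEquivalence = record
  { refl  = λ {x} → wrap (≡⇒≈ x x (λ _ → refl))
  ; sym   = λ {x} {y} p → wrap λ ε 0<ε →
      map-eventually (λ n → subst (_< ε) (abs-sub-comm (seq x n) (seq y n))) (unwrap p ε 0<ε)
  ; trans = λ {x} {y} {z} p q → wrap λ ε 0<ε →
      zip-eventually (λ n → abs-triangle< (seq x n) (seq y n) (seq z n))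
        (unwrap p (½ · ε) (0<½ε 0<ε)) (unwrap q (½ · ε) (0<½ε 0<ε))
  }

≅-setoid : Setoid _ _
≅-setoid = record { isEquivalence = ≅-isEquivalence }

open IsEquivalence ≅-isEquivalence public
  using () renaming (refl to ≅-refl; sym to ≅-sym; trans to ≅-trans)

≡⇒≅ : ∀ {x y} → (∀ n → seq x n ≡ seq y n) → x ≅ y
≡⇒≅ {x} {y} eq = wrap (≡⇒≈ x y eq)

0≤⁺ : ∀ x → (∀ n → 0ℚ ≤ seq x n) → 0ℝ ≤ᴿ x
0≤⁺ x 0≤x (ε , 0<ε , N , x<0) = ℚ.<-irrefl refl (ℚ.≤-<-trans (0≤+ (0≤x N) (ℚ.<⇒≤ 0<ε)) (x<0 N ℕ.≤-refl))

-- The hypothesis is a negation and carries no data. What can be decided is the sign of one late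
-- approximant shifted by ε/2: if nonnegative, all later terms exceed -ε; otherwise `x` would be
-- negative.
0≤⁻ : ∀ x → 0ℝ ≤ᴿ x → ∀ ε → 0ℚ < ε → Eventually λ n → 0ℚ < seq x n + ε
0≤⁻ x 0≤x ε 0<ε with cauchy x (½ · (½ · ε)) (0<½ε (0<½ε 0<ε))
... | N , close with ℚ.≤-total 0ℚ (seq x N + ½ · ε)
... | inj₁ p = N , λ n N≤n → begin-strict
  0ℚ                         ≤⟨ p ⟩
  seq x N + ½ · ε            <⟨ ℚ.+-monoˡ-< (½ · ε) (abs-sub<⁻ (seq x N) (seq x n) (close N n ℕ.≤-refl N≤n)) ⟩
  seq x n + η + ½ · ε        ≤⟨ ℚ.+-monoˡ-≤ (½ · ε) (ℚ.+-monoʳ-≤ (seq x n) η≤½ε) ⟩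
  seq x n + ½ · ε + ½ · ε    ≡⟨ trans (ℚ.+-assoc (seq x n) (½ · ε) (½ · ε)) (cong (λ z → seq x n + z) (½ε+½ε ε)) ⟩
  seq x n + ε                ∎
  where
  open ℚ.≤-Reasoning
  η = ½ · (½ · ε)
  η≤½ε : η ≤ ½ · ε
  η≤½ε = subst (η ≤_) (½ε+½ε (½ · ε)) (≤+ʳ (ℚ.<⇒≤ (0<½ε (0<½ε 0<ε))))
... | inj₂ p = contradiction (η , 0<½ε (0<½ε 0<ε) , N , λ n N≤n → begin-strict
  seq x n + η      <⟨ ℚ.+-monoˡ-< η (abs-sub<⁻ (seq x n) (seq x N) (close n N N≤n ℕ.≤-refl)) ⟩
  seq x N + η + η  ≡⟨ trans (ℚ.+-assoc (seq x N) η η) (cong (λ z → seq x N + z) (½ε+½ε (½ · ε))) ⟩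
  seq x N + ½ · ε  ≤⟨ p ⟩
  0ℚ               ∎) 0≤x
  where
  open ℚ.≤-Reasoning
  η = ½ · (½ · ε)

-- One late approximant is compared with ε/2. If it were larger, the excess would be a gap proving
-- `x` positive; if not, the later terms stay below ε.
≈0⁺ : ∀ x → 0ℝ ≤ᴿ x → ¬ (0ℝ <ᴿ x) → x ≅ 0ℝ
≈0⁺ x 0≤x x≯0 = wrap small
  where
  small : x ≈ 0ℝ
  small ε 0<ε with cauchy x (½ · ε) (0<½ε 0<ε)
  ... | N , close with ½ · ε ℚ.<? seq x N
  ... | yes p = contradiction
    ( seq x N - ½ · ε
    , subst (_< seq x N - ½ · ε) (ℚ.+-inverseʳ (½ · ε)) (ℚ.+-monoˡ-< (- (½ · ε)) p)
    , N , λ n N≤n → subst₂ _<_ (sym (ℚ.+-identityˡ (seq x N - ½ · ε)))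
        (solve 2 (λ a e → (a :+ e) :- e := a) refl (seq x n) (½ · ε))
        (ℚ.+-monoˡ-< (- (½ · ε)) (abs-sub<⁻ (seq x N) (seq x n) (close N n ℕ.≤-refl N≤n)))
    ) x≯0
  ... | no ¬p = zip-eventually (λ n u v → abs-sub<⁺ (seq x n) 0ℚ ε (x<ε n u) v)
                  (N , λ n N≤n → abs-sub<⁻ (seq x n) (seq x N) (close n N N≤n ℕ.≤-refl)) (0≤⁻ x 0≤x ε 0<ε)
    where
    open ℚ.≤-Reasoning
    x<ε : ∀ n → seq x n < seq x N + ½ · ε → seq x n < 0ℚ + ε
    x<ε n u = begin-strict
      seq x n            <⟨ u ⟩
      seq x N + ½ · ε    ≤⟨ ℚ.+-monoˡ-≤ (½ · ε) (ℚ.≮⇒≥ ¬p) ⟩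
      ½ · ε + ½ · ε      ≡⟨ trans (½ε+½ε ε) (sym (ℚ.+-identityˡ ε)) ⟩
      0ℚ + ε             ∎

-- In a² - 1 = (a + 1)(a - 1) the first factor is at least 1, so a is at least as close to 1 as its
-- square is.
square≈1⇒≈1 : ∀ x → (∀ n → 0ℚ ≤ seq x n) → x ·ᴿ x ≅ 1ℝ → x ≅ 1ℝ
square≈1⇒≈1 x 0≤x p = wrap λ ε 0<ε →
  map-eventually (λ n → ℚ.≤-<-trans (bound (seq x n) (0≤x n))) (unwrap p ε 0<ε)
  where
  open ℚ.≤-Reasoning
  bound : ∀ a → 0ℚ ≤ a → ∣ a - 1ℚ ∣ ≤ ∣ a · a - 1ℚ ∣
  bound a 0≤a = begin
    ∣ a - 1ℚ ∣                 ≡⟨ ℚ.*-identityˡ ∣ a - 1ℚ ∣ ⟨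
    1ℚ · ∣ a - 1ℚ ∣            ≤⟨ ·-monoˡ ∣ a - 1ℚ ∣ (ℚ.0≤∣p∣ (a - 1ℚ)) (≤+ˡ 0≤a) ⟩
    (a + 1ℚ) · ∣ a - 1ℚ ∣      ≡⟨ cong (_· ∣ a - 1ℚ ∣) (ℚ.0≤p⇒∣p∣≡p (0≤+ 0≤a 0≤1)) ⟨
    ∣ a + 1ℚ ∣ · ∣ a - 1ℚ ∣    ≡⟨ ℚ.∣p*q∣≡∣p∣*∣q∣ (a + 1ℚ) (a - 1ℚ) ⟨
    ∣ (a + 1ℚ) · (a - 1ℚ) ∣    ≡⟨ cong ∣_∣ (solve 1 (λ a → (a :+ con 1ℚ) :* (a :- con 1ℚ) := a :* a :- con 1ℚ) refl a) ⟩
    ∣ a · a - 1ℚ ∣             ∎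

-- Continuous functions of several real variables

record Continuous₂ (_∙_ : ℝ → ℝ → ℝ) : Set where
  constructor mkContinuous₂
  field modulus₂ : ∀ x y ε → 0ℚ < ε → ∃[ δ ] 0ℚ < δ ×
                   (∀ x′ y′ → Near δ x′ x → Near δ y′ y → Near ε (x′ ∙ y′) (x ∙ y))

open Continuous₂

-- Continuity on all of the ambient space, with rational radii. The passage to subspaces and real
-- radii is made once, in `restrict-continuous`.
record ContinuousF {k} (F : Vector ℝ k → ℝ) : Set where
  constructor mkContinuousF
  field modulus : ∀ x ε → 0ℚ < ε → ∃[ δ ] 0ℚ < δ ×
                  (∀ x′ → (∀ i → Near δ (x′ i) (x i)) → Near ε (F x′) (F x))

open ContinuousF

∙-cong : ∀ {_∙_} → Continuous₂ _∙_ → ∀ {x y x′ y′} → x′ ≅ x → y′ ≅ y → (x′ ∙ y′) ≅ (x ∙ y)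
∙-cong cts {x} {y} {x′} {y′} p q = wrap λ ε 0<ε →
  let δ , 0<δ , near = modulus₂ cts x y ε 0<ε in near x′ y′ (unwrap p δ 0<δ) (unwrap q δ 0<δ)

0<⊓ : ∀ {a b} → 0ℚ < a → 0ℚ < b → 0ℚ < a ⊓ b
0<⊓ {a} {b} p q with ℚ.⊓-sel a b
... | inj₁ eq = subst (0ℚ <_) (sym eq) p
... | inj₂ eq = subst (0ℚ <_) (sym eq) q

+-continuous : Continuous₂ _+ᴿ_
+-continuous = mkContinuous₂ λ x y ε 0<ε → ½ · ε , 0<½ε 0<ε , λ x′ y′ → zip-eventually λ n p q → begin-strict
  ∣ (seq x′ n + seq y′ n) - (seq x n + seq y n) ∣
    ≡⟨ cong ∣_∣ (+-sub (seq x′ n) (seq y′ n) (seq x n) (seq y n)) ⟩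
  ∣ (seq x′ n - seq x n) + (seq y′ n - seq y n) ∣
    ≤⟨ ℚ.∣p+q∣≤∣p∣+∣q∣ (seq x′ n - seq x n) (seq y′ n - seq y n) ⟩
  ∣ seq x′ n - seq x n ∣ + ∣ seq y′ n - seq y n ∣
    <⟨ ℚ.+-mono-< p q ⟩
  ½ · ε + ½ · ε
    ≡⟨ ½ε+½ε ε ⟩
  ε ∎
  where open ℚ.≤-Reasoning

-ᴿ-continuous : Continuous₂ _-ᴿ_
-ᴿ-continuous = mkContinuous₂ λ x y ε 0<ε → ½ · ε , 0<½ε 0<ε , λ x′ y′ → zip-eventually λ n p q → begin-strict
  ∣ (seq x′ n - seq y′ n) - (seq x n - seq y n) ∣
    ≡⟨ cong ∣_∣ (solve 4 (λ a b c d → (a :- b) :- (c :- d) := (a :- c) :- (b :- d)) refl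
                       (seq x′ n) (seq y′ n) (seq x n) (seq y n)) ⟩
  ∣ (seq x′ n - seq x n) - (seq y′ n - seq y n) ∣
    ≤⟨ ℚ.∣p-q∣≤∣p∣+∣q∣ (seq x′ n - seq x n) (seq y′ n - seq y n) ⟩
  ∣ seq x′ n - seq x n ∣ + ∣ seq y′ n - seq y n ∣
    <⟨ ℚ.+-mono-< p q ⟩
  ½ · ε + ½ · ε
    ≡⟨ ½ε+½ε ε ⟩
  ε ∎
  where open ℚ.≤-Reasoning

·-continuous : Continuous₂ _·ᴿ_
·-continuous = mkContinuous₂ λ x y ε 0<ε → δ x y 0<ε , 0<δ x y 0<ε , near x y 0<ε
  where
  module _ (x y : ℝ) {ε : ℚ} (0<ε : 0ℚ < ε) where
    open ℚ.≤-Reasoning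
    a-data = cauchy⇒bounded (seq x) (cauchy x)
    b-data = cauchy⇒bounded (seq y) (cauchy y)
    a = proj₁ a-data
    b = proj₁ b-data
    0<a+1 : 0ℚ < a + 1ℚ
    0<a+1 = ℚ.<-≤-trans 0<1 (≤+ˡ (ℚ.<⇒≤ (ℚ.positive⁻¹ a {{proj₁ (proj₂ a-data)}})))
    instance
      a+1>0 = ℚ.positive 0<a+1
      b>0 = proj₁ (proj₂ b-data)
    δ₁-data = ε/b (½ · ε) (a + 1ℚ) (0<½ε 0<ε)
    δ₂-data = ε/b (½ · ε) b (0<½ε 0<ε)
    δ₁ = proj₁ δ₁-data
    δ₂ = proj₁ δ₂-data
    -- The cap 1 keeps the perturbed first factor within a + 1, the bound against which `δ₁` is
    -- chosen.
    δ = 1ℚ ⊓ (δ₁ ⊓ δ₂)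
    0<δ : 0ℚ < δ
    0<δ = 0<⊓ 0<1 (0<⊓ (proj₁ (proj₂ δ₁-data)) (proj₁ (proj₂ δ₂-data)))
    δ≤1 : δ ≤ 1ℚ
    δ≤1 = ℚ.p⊓q≤p 1ℚ (δ₁ ⊓ δ₂)
    δ≤δ₁ : δ ≤ δ₁
    δ≤δ₁ = ℚ.≤-trans (ℚ.p⊓q≤q 1ℚ (δ₁ ⊓ δ₂)) (ℚ.p⊓q≤p δ₁ δ₂)
    δ≤δ₂ : δ ≤ δ₂
    δ≤δ₂ = ℚ.≤-trans (ℚ.p⊓q≤q 1ℚ (δ₁ ⊓ δ₂)) (ℚ.p⊓q≤q δ₁ δ₂)
    bound : ∀ c c′ d d′ → ∣ c ∣ ≤ a → ∣ d ∣ ≤ b → ∣ c′ - c ∣ < δ → ∣ d′ - d ∣ < δ →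
            ∣ c′ · d′ - c · d ∣ < ε
    bound c c′ d d′ c≤a d≤b p q = begin-strict
      ∣ c′ · d′ - c · d ∣                          ≡⟨ cong ∣_∣ (*-sub c′ d′ c d) ⟩
      ∣ c′ · (d′ - d) + d · (c′ - c) ∣             ≤⟨ ℚ.∣p+q∣≤∣p∣+∣q∣ (c′ · (d′ - d)) (d · (c′ - c)) ⟩
      ∣ c′ · (d′ - d) ∣ + ∣ d · (c′ - c) ∣
        <⟨ ℚ.+-mono-< (abs-*-< c′ (a + 1ℚ) (d′ - d) δ₁ c′≤a+1 (ℚ.<-≤-trans q δ≤δ₁))
                      (abs-*-< d b (c′ - c) δ₂ d≤b (ℚ.<-≤-trans p δ≤δ₂)) ⟩
      (a + 1ℚ) · δ₁ + b · δ₂                       ≡⟨ cong₂ _+_ (proj₂ (proj₂ δ₁-data)) (proj₂ (proj₂ δ₂-data)) ⟩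
      ½ · ε + ½ · ε                                ≡⟨ ½ε+½ε ε ⟩
      ε                                            ∎
      where
      c′≤a+1 : ∣ c′ ∣ ≤ a + 1ℚ
      c′≤a+1 = begin
        ∣ c′ ∣               ≡⟨ cong ∣_∣ (solve 2 (λ c c′ → c′ := c :+ (c′ :- c)) refl c c′) ⟩
        ∣ c + (c′ - c) ∣     ≤⟨ ℚ.∣p+q∣≤∣p∣+∣q∣ c (c′ - c) ⟩
        ∣ c ∣ + ∣ c′ - c ∣   ≤⟨ ℚ.+-mono-≤ c≤a (ℚ.≤-trans (ℚ.<⇒≤ p) δ≤1) ⟩
        a + 1ℚ               ∎
    near : ∀ x′ y′ → Near δ x′ x → Near δ y′ y → Near ε (x′ ·ᴿ y′) (x ·ᴿ y)
    near x′ y′ p q = zip-eventually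
      (λ n (x≤a , y≤b) (p , q) → bound (seq x n) (seq x′ n) (seq y n) (seq y′ n) x≤a y≤b p q)
      (zip-eventually (λ _ → _,_) (proj₂ (proj₂ a-data)) (proj₂ (proj₂ b-data)))
      (zip-eventually (λ _ → _,_) p q)

infixl 7 _⊓ᴿ_

_⊓ᴿ_ : ℝ → ℝ → ℝ
x ⊓ᴿ y = mkℝ (λ n → seq x n ⊓ seq y n) λ ε 0<ε →
  let M , p = cauchy x ε 0<ε
      N , q = cauchy y ε 0<ε
  in M ℕ.⊔ N , λ m n ≤m ≤n → ⊓-close (seq x m) (seq y m) (seq x n) (seq y n)
       (p m n (⊔-≤ˡ M N ≤m) (⊔-≤ˡ M N ≤n)) (q m n (⊔-≤ʳ M N ≤m) (⊔-≤ʳ M N ≤n))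

⊓-continuous : Continuous₂ _⊓ᴿ_
⊓-continuous = mkContinuous₂ λ x y ε 0<ε → ε , 0<ε , λ x′ y′ → zip-eventually λ n →
  ⊓-close (seq x′ n) (seq y′ n) (seq x n) (seq y n)

coordinate-continuous : ∀ {k} (i : Fin k) → ContinuousF (λ x → x i)
coordinate-continuous i = mkContinuousF λ x ε 0<ε → ε , 0<ε , λ x′ p → p i

const-continuous : ∀ {k} c → ContinuousF {k} (λ _ → c)
const-continuous c = mkContinuousF λ x ε 0<ε → ε , 0<ε , λ x′ _ → unwrap (≅-refl {c}) ε 0<ε

comp₂-continuous : ∀ {k _∙_} {F G : Vector ℝ k → ℝ} → Continuous₂ _∙_ →
                   ContinuousF F → ContinuousF G → ContinuousF (λ x → F x ∙ G x)
comp₂-continuous {F = F} {G} c f g = mkContinuousF λ x ε 0<ε →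
  let η , 0<η , c-near   = modulus₂ c (F x) (G x) ε 0<ε
      δ₁ , 0<δ₁ , f-near = modulus f x η 0<η
      δ₂ , 0<δ₂ , g-near = modulus g x η 0<η
  in δ₁ ⊓ δ₂ , 0<⊓ 0<δ₁ 0<δ₂ , λ x′ p → c-near (F x′) (G x′)
       (f-near x′ (λ i → near-weaken (x′ i) (x i) (ℚ.p⊓q≤p δ₁ δ₂) (p i)))
       (g-near x′ (λ i → near-weaken (x′ i) (x i) (ℚ.p⊓q≤q δ₁ δ₂) (p i)))

-- Stated with seq: comparing reals definitionally would unfold their Cauchy proofs.
continuous-resp : ∀ {k} {F G : Vector ℝ k → ℝ} → (∀ x n → seq (F x) n ≡ seq (G x) n) →
                  ContinuousF F → ContinuousF G
continuous-resp eq c = mkContinuousF λ x ε 0<ε →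
  let δ , 0<δ , near = modulus c x ε 0<ε
  in δ , 0<δ , λ x′ p → map-eventually
       (λ n → subst₂ (λ a b → ∣ a - b ∣ < ε) (eq x′ n) (eq x n)) (near x′ p)

∑-continuous : ∀ {k l} (F : Fin l → Vector ℝ k → ℝ) → (∀ j → ContinuousF (F j)) →
               ContinuousF (λ x → ∑ (λ j → F j x))
∑-continuous {l = zero}  F c = const-continuous 0ℝ
∑-continuous {l = suc l} F c =
  continuous-resp {F = λ x → F zero x +ᴿ ∑ (λ j → F (suc j) x)} {λ x → ∑ (λ j → F j x)} (λ _ _ → refl)
    (comp₂-continuous {_∙_ = _+ᴿ_} {F zero} {λ x → ∑ (λ j → F (suc j) x)} +-continuous
      (c zero) (∑-continuous (λ j → F (suc j)) (λ j → c (suc j))))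

∑-cong : ∀ {l} {x y : Vector ℝ l} → (∀ i → x i ≅ y i) → ∑ x ≅ ∑ y
∑-cong {zero}          p = ≅-refl
∑-cong {suc l} {x} {y} p = ≅-trans {∑ x} {x zero +ᴿ ∑ (tail x)} {∑ y} (≡⇒≅ λ _ → refl)
  (≅-trans {x zero +ᴿ ∑ (tail x)} {y zero +ᴿ ∑ (tail y)} {∑ y}
    (∙-cong {_+ᴿ_} +-continuous {y zero} {∑ (tail y)} {x zero} {∑ (tail x)} (p zero)
      (∑-cong {x = tail x} {tail y} (λ i → p (suc i)))) (≡⇒≅ λ _ → refl))

seq-∑ : ∀ {l} (x : Vector ℝ l) n → seq (∑ x) n ≡ sum (λ i → seq (x i) n)
seq-∑ {zero}  x n = refl
seq-∑ {suc l} x n = cong (seq (x zero) n +_) (seq-∑ (tail x) n)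

uniform : ∀ {k l} (F : Fin l → Vector ℝ k → ℝ) → (∀ j → ContinuousF (F j)) →
  ∀ x ε → 0ℚ < ε → ∃[ δ ] 0ℚ < δ ×
  (∀ x′ → (∀ i → Near δ (x′ i) (x i)) → ∀ j → Near ε (F j x′) (F j x))
uniform {l = zero}  F c x ε 0<ε = 1ℚ , 0<1 , λ _ _ ()
uniform {l = suc l} F c x ε 0<ε
  with modulus (c zero) x ε 0<ε | uniform (λ j → F (suc j)) (λ j → c (suc j)) x ε 0<ε
... | δ₁ , 0<δ₁ , near₁ | δ₂ , 0<δ₂ , near₂ = δ₁ ⊓ δ₂ , 0<⊓ 0<δ₁ 0<δ₂ , λ x′ p → λ
  { zero    → near₁ x′ (λ i → near-weaken (x′ i) (x i) (ℚ.p⊓q≤p δ₁ δ₂) (p i))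
  ; (suc j) → near₂ x′ (λ i → near-weaken (x′ i) (x i) (ℚ.p⊓q≤q δ₁ δ₂) (p i)) j
  }

-- Maps between subspaces and homeomorphisms

restrict : ∀ {k l} {X : Space k} {Y : Space l} (F : Fin l → Vector ℝ k → ℝ) →
           (∀ x → X x → Y (λ j → F j x)) → Point X → Point Y
restrict F mem (x , x∈X) = (λ j → F j x) , mem x x∈X

-- A ball demands a definite gap below its radius. Of the rational ε₀ below the given radius, one
-- half bounds the distance and the other half is that gap.
restrict-continuous : ∀ {k l} (X : Space k) (Y : Space l) (F : Fin l → Vector ℝ k → ℝ) →
  (∀ j → ContinuousF (F j)) → ∀ mem → Continuous {X = X} {Y} (restrict F mem)
restrict-continuous X Y F c mem (x , _) ε (ε₀ , 0<ε₀ , ε₀<ε)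
  with uniform F c x (½ · ε₀) (0<½ε 0<ε₀)
... | δ , 0<δ , near = fromℚ δ , (½ · δ , 0<½ε 0<δ , eventually λ _ → ½δ<δ) , λ (x′ , _) p j →
  ½ · ε₀ , 0<½ε 0<ε₀ , zip-eventually (expand x′ j) ε₀<ε
    (near x′ (λ i → let η , 0<η , q = p i in
      map-eventually (λ n r → subst (_< δ) (abs-sub-comm (seq (x i) n) (seq (x′ i) n))
        (ℚ.≤-<-trans (≤+ʳ (ℚ.<⇒≤ 0<η)) r)) q) j)
  where
  open ℚ.≤-Reasoning
  ½δ<δ : 0ℚ + ½ · δ < δ
  ½δ<δ = subst (0ℚ + ½ · δ <_) (½ε+½ε δ) (ℚ.+-monoˡ-< (½ · δ) (0<½ε 0<δ))
  expand : ∀ x′ j n → 0ℚ + ε₀ < seq ε n → ∣ seq (F j x′) n - seq (F j x) n ∣ < ½ · ε₀ →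
           ∣ seq (F j x) n - seq (F j x′) n ∣ + ½ · ε₀ < seq ε n
  expand x′ j n u v = begin-strict
    ∣ seq (F j x) n - seq (F j x′) n ∣ + ½ · ε₀
      ≡⟨ cong (_+ ½ · ε₀) (abs-sub-comm (seq (F j x) n) (seq (F j x′) n)) ⟩
    ∣ seq (F j x′) n - seq (F j x) n ∣ + ½ · ε₀  <⟨ ℚ.+-monoˡ-< (½ · ε₀) v ⟩
    ½ · ε₀ + ½ · ε₀                             ≡⟨ trans (½ε+½ε ε₀) (sym (ℚ.+-identityˡ ε₀)) ⟩
    0ℚ + ε₀                                     <⟨ u ⟩
    seq ε n                                     ∎

module _ {k l} (X : Space k) (Y : Space l)
  (F : Fin l → Vector ℝ k → ℝ) (F-∈ : ∀ x → X x → Y (λ j → F j x))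
  (G : Fin k → Vector ℝ l → ℝ) (G-∈ : ∀ y → Y y → X (λ i → G i y))
  (G∘F : ∀ x → X x → ∀ i → G i (λ j → F j x) ≅ x i)
  where

  -- Points are compared up to `_≋_`, for which the composite agrees with the identity everywhere;
  -- the homotopy that forgets time therefore has the right ends.
  homotopic-id : Homotopic {X = X} {X} (restrict G G-∈ ∘ restrict {X = X} {Y} F F-∈) (λ p → p)
  homotopic-id = record
    { H            = base {X = X}
    ; H-continuous = restrict-continuous (Cylinder X) X (λ i p → p (suc i))
                       (λ i → coordinate-continuous (suc i)) (λ _ p∈ → proj₂ (proj₂ p∈))
    ; H-start      = λ (p , _ , _ , p∈) _ i → unwrap (≅-sym (G∘F (tail p) p∈ i))
    ; H-end        = λ (p , _) _ i → unwrap (≅-refl {tail p i})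
    }

homeomorphism⇒≃ : ∀ {k l} (X : Space k) (Y : Space l)
  (F : Fin l → Vector ℝ k → ℝ) → (∀ j → ContinuousF (F j)) → (F-∈ : ∀ x → X x → Y (λ j → F j x)) →
  (G : Fin k → Vector ℝ l → ℝ) → (∀ i → ContinuousF (G i)) → (G-∈ : ∀ y → Y y → X (λ i → G i y)) →
  (∀ x → X x → ∀ i → G i (λ j → F j x) ≅ x i) →
  (∀ y → Y y → ∀ j → F j (λ i → G i y) ≅ y j) → X ≃ Y
homeomorphism⇒≃ X Y F F-continuous F-∈ G G-continuous G-∈ G∘F F∘G = record
  { to              = restrict F F-∈
  ; from            = restrict G G-∈
  ; to-continuous   = restrict-continuous X Y F F-continuous F-∈
  ; from-continuous = restrict-continuous Y X G G-continuous G-∈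
  ; from∘to         = homotopic-id X Y F F-∈ G G-∈ G∘F
  ; to∘from         = homotopic-id Y X G G-∈ F F-∈ F∘G
  }

-- Inverse square roots of reals

module RSqrt (E κ : ℚ) (0<κ : 0ℚ < κ) (κ≤1 : κ ≤ 1ℚ) (1≤E : 1ℚ ≤ E) (Eκ≡1 : E · κ ≡ 1ℚ) where

  open Newton E κ 0<κ κ≤1 1≤E Eκ≡1

  -- A diagonal sequence: the n-th term makes n Newton steps at the n-th approximant. Its Cauchy
  -- modulus combines that of `x` with the joint estimate in index and argument.
  rsqrt : ℝ → ℝ
  rsqrt x = mkℝ (λ n → newton n (clamp (seq x n))) λ ε 0<ε →
    let τ , 0<τ , M , close = newton-close-< ε 0<ε
        N , x-close = cauchy x τ 0<τ
    in M ℕ.⊔ N , λ m n ≤m ≤n → close m n (seq x m) (seq x n) (⊔-≤ˡ M N ≤m) (⊔-≤ˡ M N ≤n)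
         (x-close m n (⊔-≤ʳ M N ≤m) (⊔-≤ʳ M N ≤n))

  rsqrt-near : ∀ ε → 0ℚ < ε → ∃[ δ ] 0ℚ < δ × (∀ x′ x → Near δ x′ x → Near ε (rsqrt x′) (rsqrt x))
  rsqrt-near ε 0<ε =
    let τ , 0<τ , M , close = newton-close-< ε 0<ε
    in τ , 0<τ , λ x′ x → λ (N , p) → M ℕ.⊔ N , λ n ≤n →
         close n n (seq x′ n) (seq x n) (⊔-≤ˡ M N ≤n) (⊔-≤ˡ M N ≤n) (p n (⊔-≤ʳ M N ≤n))

  rsqrt-continuous : ∀ {k} (F : Vector ℝ k → ℝ) → ContinuousF F → ContinuousF (λ x → rsqrt (F x))
  rsqrt-continuous F c = mkContinuousF λ x ε 0<ε →
    let η , 0<η , near = rsqrt-near ε 0<ε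
        δ , 0<δ , F-near = modulus c x η 0<η
    in δ , 0<δ , λ x′ p → near (F x′) (F x) (F-near x′ p)

  0≤rsqrt : ∀ x n → 0ℚ ≤ seq (rsqrt x) n
  0≤rsqrt x n = ℚ.≤-trans 0≤κ (κ≤newton (clamp-bounded (seq x n)) n)

  -- Once the approximants lie in the interval, clamping leaves them unchanged, and the distance of
  -- a term from 1 is exactly the Newton error.
  rsqrt-inverts : ∀ x → Eventually (λ n → 1ℚ ≤ E · seq x n × seq x n ≤ E) → rsqrt x ·ᴿ rsqrt x ·ᴿ x ≅ 1ℝ
  rsqrt-inverts x (M , bounds) = wrap λ ε 0<ε →
    let N , small = error-small ε 0<ε
    in M ℕ.⊔ N , λ n ≤n → let xb = bounded (seq x n) (bounds n (⊔-≤ˡ M N ≤n)) in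
         subst (_< ε) (sym (distance n xb)) (small n (seq x n) (⊔-≤ʳ M N ≤n) xb)
    where
    distance : ∀ n → Bounded (seq x n) → ∣ seq (rsqrt x ·ᴿ rsqrt x ·ᴿ x) n - 1ℚ ∣ ≡ error n (seq x n)
    distance n xb rewrite clamp-id xb =
      trans (abs-sub-comm (g · g · seq x n) 1ℚ)
        (trans (cong (λ z → ∣ 1ℚ - z ∣) (ℚ.*-comm (g · g) (seq x n))) (ℚ.0≤p⇒∣p∣≡p (0≤error xb n)))
      where g = newton n (seq x n)

-- Calculation rules for reals, sums and norms

·-cong : ∀ x y x′ y′ → x ≅ x′ → y ≅ y′ → x ·ᴿ y ≅ x′ ·ᴿ y′
·-cong x y x′ y′ = ∙-cong {_·ᴿ_} ·-continuous {x′} {y′} {x} {y}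

-ᴿ-cong : ∀ x y x′ y′ → x ≅ x′ → y ≅ y′ → x -ᴿ y ≅ x′ -ᴿ y′
-ᴿ-cong x y x′ y′ = ∙-cong {_-ᴿ_} -ᴿ-continuous {x′} {y′} {x} {y}

0≤⊓ : ∀ x y → 0ℝ ≤ᴿ x → 0ℝ ≤ᴿ y → 0ℝ ≤ᴿ x ⊓ᴿ y
0≤⊓ x y 0≤x 0≤y (ε , 0<ε , x⊓y<0) =
  let N , absurd = zip-eventually clash x⊓y<0 (zip-eventually (λ _ → _,_) (0≤⁻ x 0≤x ε 0<ε) (0≤⁻ y 0≤y ε 0<ε))
  in ℚ.<-irrefl refl (absurd N ℕ.≤-refl)
  where
  clash : ∀ n → (seq x n ⊓ seq y n) + ε < 0ℚ → 0ℚ < seq x n + ε × 0ℚ < seq y n + ε → 0ℚ < 0ℚ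
  clash n r (p , q) with ℚ.⊓-sel (seq x n) (seq y n)
  ... | inj₁ eq rewrite eq = ℚ.<-trans p r
  ... | inj₂ eq rewrite eq = ℚ.<-trans q r

0<-≤ : ∀ x y → (∀ n → seq x n ≤ seq y n) → 0ℝ <ᴿ x → 0ℝ <ᴿ y
0<-≤ x y x≤y (ε , 0<ε , 0<x) = ε , 0<ε , map-eventually (λ n p → ℚ.<-≤-trans p (x≤y n)) 0<x

seq-∑-· : ∀ {k} (x y : Vector ℝ k) c n → (∀ i → seq (y i) n ≡ seq (x i) n · c) →
          seq (∑ y) n ≡ seq (∑ x) n · c
seq-∑-· x y c n eq = begin
  seq (∑ y) n                    ≡⟨ seq-∑ y n ⟩
  sum (λ i → seq (y i) n)        ≡⟨ sum-cong eq ⟩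
  sum (λ i → seq (x i) n · c)    ≡⟨ sum-· (λ i → seq (x i) n) c ⟩
  sum (λ i → seq (x i) n) · c    ≡⟨ cong (_· c) (seq-∑ x n) ⟨
  seq (∑ x) n · c                ∎
  where open ≡-Reasoning

-- Turns the inverse square root of a square into a reciprocal: r x has square 1 and nonnegative
-- terms.
product≅1 : ∀ r x → (∀ n → 0ℚ ≤ seq r n) → (∀ n → 0ℚ ≤ seq x n) →
            r ·ᴿ r ·ᴿ (x ·ᴿ x) ≅ 1ℝ → r ·ᴿ x ≅ 1ℝ
product≅1 r x 0≤r 0≤x p = square≈1⇒≈1 (r ·ᴿ x) (λ n → 0≤· (0≤r n) (0≤x n))
  (≅-trans {r ·ᴿ x ·ᴿ (r ·ᴿ x)} {r ·ᴿ r ·ᴿ (x ·ᴿ x)} {1ℝ} (≡⇒≅ λ n → rearrange (seq r n) (seq x n)) p)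
  where
  rearrange : ∀ r a → r · a · (r · a) ≡ r · r · (a · a)
  rearrange = solve 2 (λ r a → r :* a :* (r :* a) := r :* r :* (a :* a)) refl

‖_‖² : ∀ {k} → Vector ℝ k → ℝ
‖ x ‖² = ∑ (λ i → x i ·ᴿ x i)

module _ (a : ℚ) (near : ∣ a - 1ℚ ∣ < ½) where

  half< : ½ < a
  half< = subst (½ <_) (add-sub a ½) (ℚ.+-monoˡ-< (- ½) (abs-sub<⁻′ a 1ℚ {½} near))
    where
    add-sub : ∀ a c → (a + c) - c ≡ a
    add-sub = solve 2 (λ a c → (a :+ c) :- c := a) refl

  <3/2 : a < 1ℚ + ½
  <3/2 = abs-sub<⁻ a 1ℚ {½} near

near-one : ∀ x → x ≅ 1ℝ → Eventually λ l → ½ < seq x l × seq x l < 1ℚ + ½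
near-one x x≅1 = N , λ l N≤l → half< (seq x l) (close l N≤l) , <3/2 (seq x l) (close l N≤l)
  where
  N = proj₁ (unwrap x≅1 ½ 0<½)
  close : ∀ l → N ℕ.≤ l → ∣ seq x l - 1ℚ ∣ < ½
  close = proj₂ (unwrap x≅1 ½ 0<½)

-- The polytope of triples with minimum 0 and total sum 1

module Join {n m} (β : Fin n ↔ (Fin m × Fin 3)) where

  open Inverse β using () renaming (to to position; from to at′)

  at : Fin m → Fin 3 → Fin n
  at v j = at′ (v , j)

  position-at : ∀ v j → position (at v j) ≡ (v , j)
  position-at v j = Inverse.strictlyInverseˡ β (v , j)

  at-position : ∀ k → at (proj₁ (position k)) (proj₂ (position k)) ≡ k
  at-position k = Inverse.strictlyInverseʳ β k

  d : ℕ
  d = m ℕ.* 2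

  low₃ : (Fin 3 → ℝ) → ℝ
  low₃ u = u 0F ⊓ᴿ (u 1F ⊓ᴿ u 2F)

  pad : Vector ℝ d → Fin m → Fin 3 → ℝ
  pad x v 0F = x (combine v 0F)
  pad x v 1F = x (combine v 1F)
  pad x v 2F = 0ℝ

  lift₃ : Vector ℝ d → Fin m × Fin 3 → ℝ
  lift₃ x (v , j) = pad x v j -ᴿ low₃ (pad x v)

  lift : Vector ℝ d → Vector ℝ n
  lift x k = lift₃ x (position k)

  -- The gauge whose unit sphere is the flattened polytope.
  size : Vector ℝ d → ℝ
  size x = ∑ (lift x)

  flatten₂ : Vector ℝ n → Fin m × Fin 2 → ℝ
  flatten₂ t (v , j) = t (at v (inject₁ j)) -ᴿ t (at v 2F)

  flatten : Vector ℝ n → Vector ℝ d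
  flatten t i = flatten₂ t (remQuot 2 i)

  module _ (u : Fin 3 → ℝ) (l : ℕ) where

    low₃≤ : ∀ j → seq (low₃ u) l ≤ seq (u j) l
    low₃≤ 0F = ℚ.p⊓q≤p (seq (u 0F) l) (seq (u 1F) l ⊓ seq (u 2F) l)
    low₃≤ 1F = ℚ.≤-trans (ℚ.p⊓q≤q (seq (u 0F) l) (seq (u 1F) l ⊓ seq (u 2F) l))
                 (ℚ.p⊓q≤p (seq (u 1F) l) (seq (u 2F) l))
    low₃≤ 2F = ℚ.≤-trans (ℚ.p⊓q≤q (seq (u 0F) l) (seq (u 1F) l ⊓ seq (u 2F) l))
                 (ℚ.p⊓q≤q (seq (u 1F) l) (seq (u 2F) l))

    low₃-attained : ∃[ j ] seq (low₃ u) l ≡ seq (u j) l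
    low₃-attained with ℚ.⊓-sel (seq (u 0F) l) (seq (u 1F) l ⊓ seq (u 2F) l)
                     | ℚ.⊓-sel (seq (u 1F) l) (seq (u 2F) l)
    ... | inj₁ p | _      = 0F , p
    ... | inj₂ p | inj₁ q = 1F , trans p q
    ... | inj₂ p | inj₂ q = 2F , trans p q

  -- A positive minimum would make all three entries positive, so the minimum is nonnegative but not
  -- positive. No entry equal to 0 has to be singled out.
  low₃≅0⁺ : ∀ u → (∀ j → 0ℝ ≤ᴿ u j) → ¬ (∀ j → 0ℝ <ᴿ u j) → low₃ u ≅ 0ℝ
  low₃≅0⁺ u 0≤u u≯0 = ≈0⁺ (low₃ u)
    (0≤⊓ (u 0F) (u 1F ⊓ᴿ u 2F) (0≤u 0F) (0≤⊓ (u 1F) (u 2F) (0≤u 1F) (0≤u 2F)))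
    (λ 0<low → u≯0 (λ j → 0<-≤ (low₃ u) (u j) (λ l → low₃≤ u l j) 0<low))

  -- Used for translations, in `lift-flatten`, and for scaling by a nonnegative factor, in `lift-·`.
  low₃-monotone : ∀ (f : ℚ → ℚ) → (∀ {a b} → a ≤ b → f a ≤ f b) → ∀ u w l →
    (∀ j → seq (w j) l ≡ f (seq (u j) l)) → seq (low₃ w) l ≡ f (seq (low₃ u) l)
  low₃-monotone f mono u w l eq = begin
    seq (w 0F) l ⊓ (seq (w 1F) l ⊓ seq (w 2F) l)
      ≡⟨ cong₂ _⊓_ (eq 0F) (cong₂ _⊓_ (eq 1F) (eq 2F)) ⟩
    f (seq (u 0F) l) ⊓ (f (seq (u 1F) l) ⊓ f (seq (u 2F) l))
      ≡⟨ cong (f (seq (u 0F) l) ⊓_) (ℚ.mono-≤-distrib-⊓ {f} mono (seq (u 1F) l) (seq (u 2F) l)) ⟨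
    f (seq (u 0F) l) ⊓ f (seq (u 1F) l ⊓ seq (u 2F) l)
      ≡⟨ ℚ.mono-≤-distrib-⊓ {f} mono (seq (u 0F) l) (seq (u 1F) l ⊓ seq (u 2F) l) ⟨
    f (seq (u 0F) l ⊓ (seq (u 1F) l ⊓ seq (u 2F) l)) ∎
    where open ≡-Reasoning

  0≤lift : ∀ x k l → 0ℚ ≤ seq (lift x k) l
  0≤lift x k l = let v , j = position k in
    0≤-diff (seq (low₃ (pad x v)) l) (seq (pad x v j) l) (low₃≤ (pad x v) l j)

  -- The index `j` may vary with `l`, since the least entry is known only for each approximant
  -- separately.
  lift-vanishes : ∀ x v l → ∃[ j ] seq (lift x (at v j)) l ≡ 0ℚ
  lift-vanishes x v l = let j , eq = low₃-attained (pad x v) l in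
    j , trans (cong (λ c → seq (lift₃ x c) l) (position-at v j))
          (trans (cong (λ z → seq (pad x v j) l - z) eq) (ℚ.+-inverseʳ (seq (pad x v j) l)))

  flatten-lift : ∀ x i l → seq (flatten (lift x) i) l ≡ seq (x i) l
  flatten-lift x i l = trans (pair (remQuot 2 i)) (cong (λ i → seq (x i) l) (combine-remQuot {m} 2 i))
    where
    cancel : ∀ a c → (a - c) - (0ℚ - c) ≡ a
    cancel = solve 2 (λ a c → (a :- c) :- (con 0ℚ :- c) := a) refl
    pair : ∀ (c : Fin m × Fin 2) → seq (flatten₂ (lift x) c) l ≡ seq (x (combine (proj₁ c) (proj₂ c))) l
    pair (v , 0F) rewrite position-at v 0F | position-at v 2F =
      cancel (seq (x (combine v 0F)) l) (seq (low₃ (pad x v)) l)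
    pair (v , 1F) rewrite position-at v 1F | position-at v 2F =
      cancel (seq (x (combine v 1F)) l) (seq (low₃ (pad x v)) l)

  -- Subtracting the last entry shifts the triple and its minimum alike and cancels. On the polytope
  -- the remaining minimum is 0, which makes `lift` inverse to `flatten` there.
  lift-flatten : ∀ t k l → seq (lift (flatten t) k) l ≡
                 seq (t k) l - seq (low₃ (λ j → t (at (proj₁ (position k)) j))) l
  lift-flatten t k l = begin
    seq (pad (flatten t) v j) l - seq (low₃ (pad (flatten t) v)) l
      ≡⟨ cong₂ _-_ (pad-flatten j)
           (low₃-monotone (_- c) (ℚ.+-monoˡ-≤ (- c)) (λ j → t (at v j)) (pad (flatten t) v) l pad-flatten) ⟩
    (seq (t (at v j)) l - c) - (seq (low₃ (λ j → t (at v j))) l - c)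
      ≡⟨ solve 3 (λ a b c → (a :- c) :- (b :- c) := a :- b) refl
           (seq (t (at v j)) l) (seq (low₃ (λ j → t (at v j))) l) c ⟩
    seq (t (at v j)) l - seq (low₃ (λ j → t (at v j))) l
      ≡⟨ cong (λ k → seq (t k) l - seq (low₃ (λ j → t (at v j))) l) (at-position k) ⟩
    seq (t k) l - seq (low₃ (λ j → t (at v j))) l ∎
    where
    open ≡-Reasoning
    v = proj₁ (position k)
    j = proj₂ (position k)
    c = seq (t (at v 2F)) l
    pad-flatten : ∀ j → seq (pad (flatten t) v j) l ≡ seq (t (at v j)) l - c
    pad-flatten 0F = cong (λ q → seq (flatten₂ t q) l) (remQuot-combine {m} {2} v 0F)
    pad-flatten 1F = cong (λ q → seq (flatten₂ t q) l) (remQuot-combine {m} {2} v 1F)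
    pad-flatten 2F = sym (ℚ.+-inverseʳ c)

  -- Positive homogeneity, the property that lets `lift` and `size` commute with radial projection.
  lift-· : ∀ x y l c → 0ℚ ≤ c → (∀ i → seq (y i) l ≡ seq (x i) l · c) →
           ∀ k → seq (lift y k) l ≡ seq (lift x k) l · c
  lift-· x y l c 0≤c eq k = trans
    (cong₂ _-_ (pad-· j) (low₃-monotone (_· c) (·-monoˡ c 0≤c) (pad x v) (pad y v) l pad-·))
    (solve 3 (λ a b c → a :* c :- b :* c := (a :- b) :* c) refl
       (seq (pad x v j) l) (seq (low₃ (pad x v)) l) c)
    where
    v = proj₁ (position k)
    j = proj₂ (position k)
    pad-· : ∀ j → seq (pad y v j) l ≡ seq (pad x v j) l · c
    pad-· 0F = eq (combine v 0F)
    pad-· 1F = eq (combine v 1F)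
    pad-· 2F = sym (ℚ.*-zeroˡ c)

  -- Comparison of the gauge with the Euclidean norm

  lift≤size : ∀ x k l → seq (lift x k) l ≤ seq (size x) l
  lift≤size x k l = subst (seq (lift x k) l ≤_) (sym (seq-∑ (lift x) l)) (term≤sum (λ k → 0≤lift x k l) k)

  0≤size : ∀ x l → 0ℚ ≤ seq (size x) l
  0≤size x l = subst (0ℚ ≤_) (sym (seq-∑ (lift x) l)) (0≤sum (λ k → 0≤lift x k l))

  -- Each coordinate is a difference of two lifted entries, both between 0 and the gauge.
  ‖‖²≤size² : ∀ x l → seq ‖ x ‖² l ≤ ν d · (seq (size x) l · seq (size x) l)
  ‖‖²≤size² x l = subst (_≤ ν d · (N · N)) (sym (seq-∑ (λ i → x i ·ᴿ x i) l))
    (sum≤ {f = λ i → seq (x i) l · seq (x i) l} λ i → subst (_≤ N · N) (abs-square (seq (x i) l))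
      (·-mono (ℚ.0≤∣p∣ (seq (x i) l)) (0≤size x l) (∣x∣≤N i) (∣x∣≤N i)))
    where
    N = seq (size x) l
    ∣x∣≤N : ∀ i → ∣ seq (x i) l ∣ ≤ N
    ∣x∣≤N i = subst (λ z → ∣ z ∣ ≤ N) (flatten-lift x i l)
      (abs≤⁺ (bound a b (0≤lift x _ l) (lift≤size x _ l))
             (subst (_≤ N) (sym (flip-sub a b)) (bound b a (0≤lift x _ l) (lift≤size x _ l))))
      where
      c = remQuot 2 i
      a = seq (lift x (at (proj₁ c) (inject₁ (proj₂ c)))) l
      b = seq (lift x (at (proj₁ c) 2F)) l
      bound : ∀ a b → 0ℚ ≤ b → a ≤ N → a - b ≤ N
      bound a b 0≤b a≤N = subst (a - b ≤_) (ℚ.+-identityʳ N) (ℚ.+-mono-≤ a≤N (ℚ.neg-antimono-≤ 0≤b))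

  -- Each lifted entry is a difference of two padded entries, and a bound on the norm bounds every
  -- coordinate by `δ`.
  size≤ : ∀ x l δ → 0ℚ ≤ δ → seq ‖ x ‖² l ≤ δ · δ → seq (size x) l ≤ ν n · (δ + δ)
  size≤ x l δ 0≤δ s≤δ² = subst (_≤ ν n · (δ + δ)) (sym (seq-∑ (lift x) l))
    (sum≤ {f = λ k → seq (lift x k) l} lift≤)
    where
    ∣x∣≤δ : ∀ i → ∣ seq (x i) l ∣ ≤ δ
    ∣x∣≤δ i = square-cancel-≤ 0≤δ (ℚ.≤-trans
      (term≤sum {f = λ i → seq (x i) l · seq (x i) l} (λ i → 0≤square (seq (x i) l)) i)
      (subst (_≤ δ · δ) (seq-∑ (λ i → x i ·ᴿ x i) l) s≤δ²))
    ∣pad∣≤δ : ∀ v j → ∣ seq (pad x v j) l ∣ ≤ δ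
    ∣pad∣≤δ v 0F = ∣x∣≤δ (combine v 0F)
    ∣pad∣≤δ v 1F = ∣x∣≤δ (combine v 1F)
    ∣pad∣≤δ v 2F = 0≤δ
    lift≤ : ∀ k → seq (lift x k) l ≤ δ + δ
    lift≤ k = let v , j = position k
                  i , eq = low₃-attained (pad x v) l
                  a = seq (pad x v j) l
                  b = seq (pad x v i) l in
      subst (λ z → a - z ≤ δ + δ) (sym eq)
        (ℚ.+-mono-≤ (ℚ.≤-trans (a≤∣a∣ a) (∣pad∣≤δ v j)) (ℚ.≤-trans (-a≤∣a∣ b) (∣pad∣≤δ v i)))

  1≤· : ∀ {a b} → 1ℚ ≤ a → 1ℚ ≤ b → 1ℚ ≤ a · b
  1≤· p q = ·-mono 0≤1 (ℚ.≤-trans 0≤1 p) p q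

  -- [1/E , E] contains size² on the sphere and ‖_‖² on the flattened polytope.
  A b E : ℚ
  A = ν 4 · ν (suc n)
  b = ν (suc d)
  E = A · A · b

  1≤b : 1ℚ ≤ b
  1≤b = ≤+ʳ (0≤ν d)

  1≤ν[1+n] : 1ℚ ≤ ν (suc n)
  1≤ν[1+n] = ≤+ʳ (0≤ν n)

  1≤A : 1ℚ ≤ A
  1≤A = 1≤· {ν 4} (ν-mono {1} {4} (ℕ.s≤s ℕ.z≤n)) 1≤ν[1+n]

  0≤A : 0ℚ ≤ A
  0≤A = ℚ.≤-trans 0≤1 1≤A

  ν2≤A : ν 2 ≤ A
  ν2≤A = ℚ.≤-trans (ν-mono {2} {4} (ℕ.s≤s (ℕ.s≤s ℕ.z≤n)))
    (subst (_≤ A) (ℚ.*-identityʳ (ν 4)) (·-monoʳ (ν 4) (0≤ν 4) 1≤ν[1+n]))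

  1≤E : 1ℚ ≤ E
  1≤E = 1≤· (1≤· 1≤A 1≤A) 1≤b

  AA≤E : A · A ≤ E
  AA≤E = subst (_≤ E) (ℚ.*-identityʳ (A · A)) (·-monoʳ (A · A) (0≤square A) 1≤b)

  κ-data : ∃[ κ ] 0ℚ < κ × E · κ ≡ 1ℚ
  κ-data = ε/b 1ℚ E {{ℚ.positive (ℚ.<-≤-trans 0<1 1≤E)}} 0<1

  δ-data : ∃[ δ ] 0ℚ < δ × A · δ ≡ 1ℚ
  δ-data = ε/b 1ℚ A {{ℚ.positive (ℚ.<-≤-trans 0<1 1≤A)}} 0<1

  κ : ℚ
  κ = proj₁ κ-data

  0<κ : 0ℚ < κ
  0<κ = proj₁ (proj₂ κ-data)

  Eκ≡1 : E · κ ≡ 1ℚ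
  Eκ≡1 = proj₂ (proj₂ κ-data)

  κ≤1 : κ ≤ 1ℚ
  κ≤1 = subst₂ _≤_ (ℚ.*-identityˡ κ) Eκ≡1 (·-monoˡ κ (ℚ.<⇒≤ 0<κ) 1≤E)

  -- Above: the squared norm is below 3/2 ≤ 2², so the gauge is at most 4n ≤ A. Below: 1/2 < d N²
  -- gives 1 ≤ 2d N², and 2d ≤ E.
  size²-bounds : ∀ x l → ½ < seq ‖ x ‖² l × seq ‖ x ‖² l < 1ℚ + ½ →
                  1ℚ ≤ E · seq (size x ·ᴿ size x) l × seq (size x ·ᴿ size x) l ≤ E
  size²-bounds x l (½<s , s<3/2) = 1≤ENN , (ℚ.≤-trans (·-mono (0≤size x l) 0≤A N≤A N≤A) AA≤E)
    where
    open ℚ.≤-Reasoning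
    s = seq ‖ x ‖² l
    N = seq (size x) l
    3/2≤4 : 1ℚ + ½ ≤ ν 2 · ν 2
    3/2≤4 = toWitness {a? = (1ℚ + ½) ℚ.≤? (ν 2 · ν 2)} _
    N≤A : N ≤ A
    N≤A = begin
      N                     ≤⟨ size≤ x l (ν 2) (0≤ν 2) (ℚ.≤-trans (ℚ.<⇒≤ s<3/2) 3/2≤4) ⟩
      ν n · (ν 2 + ν 2)     ≡⟨ ℚ.*-comm (ν n) (ν 4) ⟩
      ν 4 · ν n             ≤⟨ ·-monoʳ (ν 4) (0≤ν 4) (ν≤ν-suc n) ⟩
      A                     ∎
    ν2νd≤E : ν 2 · ν d ≤ E
    ν2νd≤E = ·-mono (0≤ν d) (0≤square A)
      (ℚ.≤-trans ν2≤A (subst (_≤ A · A) (ℚ.*-identityʳ A) (·-monoʳ A 0≤A 1≤A))) (ν≤ν-suc d)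
    1≤ENN : 1ℚ ≤ E · (N · N)
    1≤ENN = begin
      ν 2 · ½                ≤⟨ ·-monoʳ (ν 2) (0≤ν 2) (ℚ.≤-trans (ℚ.<⇒≤ ½<s) (‖‖²≤size² x l)) ⟩
      ν 2 · (ν d · (N · N))  ≡⟨ ℚ.*-assoc (ν 2) (ν d) (N · N) ⟨
      ν 2 · ν d · (N · N)    ≤⟨ ·-monoˡ (N · N) (0≤square N) ν2νd≤E ⟩
      E · (N · N)            ∎

  -- Above: s ≤ d N² ≤ b A². Below, by contradiction: E s ≤ 1 forces s ≤ δ² with δ = 1/A, so the
  -- gauge is at most 2(n + 1)/A = 1/2. This is where the factor 4 in `A` is used up.
  ‖‖²-bounds : ∀ x l → ½ < seq (size x) l × seq (size x) l < 1ℚ + ½ →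
                1ℚ ≤ E · seq ‖ x ‖² l × seq ‖ x ‖² l ≤ E
  ‖‖²-bounds x l (½<N , N<3/2) = 1≤Es , s≤E
    where
    open ℚ.≤-Reasoning
    s = seq ‖ x ‖² l
    N = seq (size x) l
    δ = proj₁ δ-data
    0≤δ = ℚ.<⇒≤ (proj₁ (proj₂ δ-data))
    Aδ≡1 = proj₂ (proj₂ δ-data)
    N≤A : N ≤ A
    N≤A = ℚ.≤-trans (ℚ.<⇒≤ N<3/2) (ℚ.≤-trans (toWitness {a? = (1ℚ + ½) ℚ.≤? ν 2} _) ν2≤A)
    0≤s : 0ℚ ≤ s
    0≤s = subst (0ℚ ≤_) (sym (seq-∑ (λ i → x i ·ᴿ x i) l))
      (0≤sum {f = λ i → seq (x i) l · seq (x i) l} λ i → 0≤square (seq (x i) l))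
    s≤E : s ≤ E
    s≤E = begin
      s              ≤⟨ ‖‖²≤size² x l ⟩
      ν d · (N · N)  ≤⟨ ·-mono (0≤square N) (ℚ.≤-trans 0≤1 1≤b) (ν≤ν-suc d) (·-mono (0≤size x l) 0≤A N≤A N≤A) ⟩
      b · (A · A)    ≡⟨ ℚ.*-comm b (A · A) ⟩
      E              ∎
    N≤½ : E · s ≤ 1ℚ → N ≤ ½
    N≤½ Es≤1 = begin
      N                             ≤⟨ size≤ x l δ 0≤δ s≤δδ ⟩
      ν n · (δ + δ)                 ≤⟨ ·-monoˡ (δ + δ) (0≤+ 0≤δ 0≤δ) (ν≤ν-suc n) ⟩
      ν (suc n) · (δ + δ)           ≡⟨ solve 2 (λ a δ → a :* (δ :+ δ) := con ½ :* (con (ν 4) :* a :* δ)) refl (ν (suc n)) δ ⟩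
      ½ · (A · δ)                   ≡⟨ cong (½ ·_) Aδ≡1 ⟩
      ½                             ∎
      where
      s≤δδ : s ≤ δ · δ
      s≤δδ = begin
        s                            ≡⟨ ℚ.*-identityʳ s ⟨
        s · (1ℚ · 1ℚ)                ≡⟨ cong (λ z → s · (z · z)) Aδ≡1 ⟨
        s · ((A · δ) · (A · δ))      ≡⟨ solve 3 (λ s A δ → s :* ((A :* δ) :* (A :* δ)) := A :* A :* s :* (δ :* δ))
                                          refl s A δ ⟩
        A · A · s · (δ · δ)          ≤⟨ ·-monoˡ (δ · δ) (0≤square δ) (ℚ.≤-trans (·-monoˡ s 0≤s AA≤E) Es≤1) ⟩
        1ℚ · (δ · δ)                 ≡⟨ ℚ.*-identityˡ (δ · δ) ⟩
        δ · δ                        ∎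
    1≤Es : 1ℚ ≤ E · s
    1≤Es = ℚ.≮⇒≥ {E · s} {1ℚ} λ Es<1 → ℚ.<-irrefl {½} refl (ℚ.<-≤-trans ½<N (N≤½ (ℚ.<⇒≤ Es<1)))

  low₃≅0⇒lift-flatten≅ : ∀ t k → low₃ (λ j → t (at (proj₁ (position k)) j)) ≅ 0ℝ → lift (flatten t) k ≅ t k
  low₃≅0⇒lift-flatten≅ t k low≅0 = begin
    lift (flatten t) k                                  ≈⟨ ≡⇒≅ (lift-flatten t k) ⟩
    t k -ᴿ low₃ (λ j → t (at (proj₁ (position k)) j))   ≈⟨ -ᴿ-cong (t k) (low₃ (λ j → t (at (proj₁ (position k)) j)))
                                                             (t k) 0ℝ ≅-refl low≅0 ⟩
    t k -ᴿ 0ℝ                                           ≈⟨ ≡⇒≅ (λ l → ℚ.+-identityʳ (seq (t k) l)) ⟩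
    t k                                                 ∎
    where open SetoidReasoning ≅-setoid

  -- Cancellation of the two radial projections

  module _ (p x : Vector ℝ d) (ρ σ : ℝ) where

    open SetoidReasoning ≅-setoid

    -- The two factors multiply to 1: σ²‖p‖² = σ²ρ²‖x‖² = (σρ)², and both are nonnegative.
    rescale-to-sphere :
      (∀ i l → seq (p i) l ≡ seq (x i) l · seq ρ l) → (∀ l → 0ℚ ≤ seq ρ l) → (∀ l → 0ℚ ≤ seq σ l) →
      ‖ x ‖² ≅ 1ℝ → σ ·ᴿ σ ·ᴿ ‖ p ‖² ≅ 1ℝ → ∀ i → p i ·ᴿ σ ≅ x i
    rescale-to-sphere p≡xρ 0≤ρ 0≤σ ‖x‖≅1 σσ‖p‖≅1 i = begin
      p i ·ᴿ σ          ≈⟨ ≡⇒≅ (λ l → trans (cong (_· seq σ l) (p≡xρ i l))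
                                           (regroup (seq (x i) l) (seq ρ l) (seq σ l))) ⟩
      x i ·ᴿ (σ ·ᴿ ρ)   ≈⟨ ·-cong (x i) (σ ·ᴿ ρ) (x i) 1ℝ ≅-refl (product≅1 σ ρ 0≤σ 0≤ρ σσρρ≅1) ⟩
      x i ·ᴿ 1ℝ         ≈⟨ ≡⇒≅ (λ l → ℚ.*-identityʳ (seq (x i) l)) ⟩
      x i               ∎
      where
      regroup : ∀ x r s → x · r · s ≡ x · (s · r)
      regroup = solve 3 (λ x r s → x :* r :* s := x :* (s :* r)) refl
      squares : ∀ a b r → a ≡ b · r → a · a ≡ b · b · (r · r)
      squares _ b r refl = solve 2 (λ b r → (b :* r) :* (b :* r) := b :* b :* (r :* r)) refl b r
      ‖p‖²≡ : ∀ l → seq ‖ p ‖² l ≡ seq ‖ x ‖² l · (seq ρ l · seq ρ l)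
      ‖p‖²≡ l = seq-∑-· (λ i → x i ·ᴿ x i) (λ i → p i ·ᴿ p i) (seq ρ l · seq ρ l) l
        (λ i → squares (seq (p i) l) (seq (x i) l) (seq ρ l) (p≡xρ i l))
      σσρρ≅1 : σ ·ᴿ σ ·ᴿ (ρ ·ᴿ ρ) ≅ 1ℝ
      σσρρ≅1 = begin
        σ ·ᴿ σ ·ᴿ (ρ ·ᴿ ρ)
          ≈⟨ ≡⇒≅ (λ l → cong (seq σ l · seq σ l ·_) (sym (ℚ.*-identityˡ (seq ρ l · seq ρ l)))) ⟩
        σ ·ᴿ σ ·ᴿ (1ℝ ·ᴿ (ρ ·ᴿ ρ))
          ≈⟨ ·-cong (σ ·ᴿ σ) (1ℝ ·ᴿ (ρ ·ᴿ ρ)) (σ ·ᴿ σ) (‖ x ‖² ·ᴿ (ρ ·ᴿ ρ)) ≅-refl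
               (·-cong 1ℝ (ρ ·ᴿ ρ) ‖ x ‖² (ρ ·ᴿ ρ) (≅-sym ‖x‖≅1) ≅-refl) ⟩
        σ ·ᴿ σ ·ᴿ (‖ x ‖² ·ᴿ (ρ ·ᴿ ρ))
          ≈⟨ ≡⇒≅ (λ l → cong (seq σ l · seq σ l ·_) (sym (‖p‖²≡ l))) ⟩
        σ ·ᴿ σ ·ᴿ ‖ p ‖²
          ≈⟨ σσ‖p‖≅1 ⟩
        1ℝ ∎

    -- The gauge is homogeneous of degree 1, so here 1 = ρ size x = ρσ size p = ρσ without passing
    -- through squares.
    rescale-to-polytope :
      (∀ i l → seq (x i) l ≡ seq (p i) l · seq σ l) → (∀ l → 0ℚ ≤ seq σ l) →
      size p ≅ 1ℝ → ρ ·ᴿ size x ≅ 1ℝ → ∀ k → lift x k ·ᴿ ρ ≅ lift p k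
    rescale-to-polytope x≡pσ 0≤σ size-p≅1 ρ-size-x≅1 k = begin
      lift x k ·ᴿ ρ          ≈⟨ ≡⇒≅ (λ l → trans (cong (_· seq ρ l) (lift≡ l k))
                                                (regroup (seq (lift p k) l) (seq ρ l) (seq σ l))) ⟩
      lift p k ·ᴿ (ρ ·ᴿ σ)   ≈⟨ ·-cong (lift p k) (ρ ·ᴿ σ) (lift p k) 1ℝ ≅-refl ρσ≅1 ⟩
      lift p k ·ᴿ 1ℝ         ≈⟨ ≡⇒≅ (λ l → ℚ.*-identityʳ (seq (lift p k) l)) ⟩
      lift p k               ∎
      where
      regroup : ∀ x r s → x · s · r ≡ x · (r · s)
      regroup = solve 3 (λ x r s → x :* s :* r := x :* (r :* s)) refl
      lift≡ : ∀ l k → seq (lift x k) l ≡ seq (lift p k) l · seq σ l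
      lift≡ l = lift-· p x l (seq σ l) (0≤σ l) (λ i → x≡pσ i l)
      ρσ≅1 : ρ ·ᴿ σ ≅ 1ℝ
      ρσ≅1 = begin
        ρ ·ᴿ σ
          ≈⟨ ≡⇒≅ (λ l → cong (seq ρ l ·_) (sym (ℚ.*-identityˡ (seq σ l)))) ⟩
        ρ ·ᴿ (1ℝ ·ᴿ σ)
          ≈⟨ ·-cong ρ (1ℝ ·ᴿ σ) ρ (size p ·ᴿ σ) ≅-refl (·-cong 1ℝ σ (size p) σ (≅-sym size-p≅1) ≅-refl) ⟩
        ρ ·ᴿ (size p ·ᴿ σ)
          ≈⟨ ≡⇒≅ (λ l → cong (seq ρ l ·_) (sym (seq-∑-· (lift p) (lift x) (seq σ l) l (lift≡ l)))) ⟩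
        ρ ·ᴿ size x
          ≈⟨ ρ-size-x≅1 ⟩
        1ℝ ∎

  -- The inverse square root is a parameter, so that it never unfolds in conversion checks.
  module Homeomorphism
    (K : SimplicialComplex n) (block : Fin m → Subset n)
    (∈block⁻ : ∀ v {k} → k ∈ block v → proj₁ (position k) ≡ v)
    (block-not-face : ∀ v → ¬ SimplicialComplex.Face K (block v))
    (mk-face : ∀ σ → (∀ v → ¬ (∀ j → at v j ∈ σ)) → SimplicialComplex.Face K σ)
    (rsqrt : ℝ → ℝ)
    (rsqrt-continuous : ∀ {k} (F : Vector ℝ k → ℝ) → ContinuousF F → ContinuousF (λ x → rsqrt (F x)))
    (0≤rsqrt : ∀ x l → 0ℚ ≤ seq (rsqrt x) l)
    (rsqrt-inverts : ∀ x → Eventually (λ l → 1ℚ ≤ E · seq x l × seq x l ≤ E) → rsqrt x ·ᴿ rsqrt x ·ᴿ x ≅ 1ℝ)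
    where

    size-inverted : ∀ x → ‖ x ‖² ≅ 1ℝ → rsqrt (size x ·ᴿ size x) ·ᴿ size x ≅ 1ℝ
    size-inverted x x∈S = product≅1 (rsqrt (size x ·ᴿ size x)) (size x) (0≤rsqrt (size x ·ᴿ size x)) (0≤size x)
      (rsqrt-inverts (size x ·ᴿ size x)
        (let M , p = near-one ‖ x ‖² x∈S in M , λ l M≤l → size²-bounds x l (p l M≤l)))

    ‖‖²-inverted : ∀ x → size x ≅ 1ℝ → rsqrt ‖ x ‖² ·ᴿ rsqrt ‖ x ‖² ·ᴿ ‖ x ‖² ≅ 1ℝ
    ‖‖²-inverted x size≅1 = rsqrt-inverts ‖ x ‖²
      (let M , p = near-one (size x) size≅1 in M , λ l M≤l → ‖‖²-bounds x l (p l M≤l))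

    toSphere : Fin d → Vector ℝ n → ℝ
    toSphere i t = flatten t i ·ᴿ rsqrt ‖ flatten t ‖²

    fromSphere : Fin n → Vector ℝ d → ℝ
    fromSphere k x = lift x k ·ᴿ rsqrt (size x ·ᴿ size x)

    pad-continuous : ∀ v j → ContinuousF (λ x → pad x v j)
    pad-continuous v 0F = coordinate-continuous (combine v 0F)
    pad-continuous v 1F = coordinate-continuous (combine v 1F)
    pad-continuous v 2F = const-continuous 0ℝ

    lift-continuous : ∀ k → ContinuousF (λ x → lift x k)
    lift-continuous k = let v , j = position k in
      comp₂-continuous {_∙_ = _-ᴿ_} {λ x → pad x v j} {λ x → low₃ (pad x v)} -ᴿ-continuous (pad-continuous v j)
        (comp₂-continuous {_∙_ = _⊓ᴿ_} {λ x → pad x v 0F} {λ x → pad x v 1F ⊓ᴿ pad x v 2F}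
          ⊓-continuous (pad-continuous v 0F)
          (comp₂-continuous {_∙_ = _⊓ᴿ_} {λ x → pad x v 1F} {λ x → pad x v 2F} ⊓-continuous
            (pad-continuous v 1F) (pad-continuous v 2F)))

    flatten-continuous : ∀ i → ContinuousF (λ t → flatten t i)
    flatten-continuous i = let v , j = remQuot {m} 2 i in
      comp₂-continuous {_∙_ = _-ᴿ_} {λ t → t (at v (inject₁ j))} {λ t → t (at v 2F)} -ᴿ-continuous
        (coordinate-continuous (at v (inject₁ j))) (coordinate-continuous (at v 2F))

    size-continuous : ContinuousF size
    size-continuous = ∑-continuous (λ k x → lift x k) lift-continuous

    toSphere-continuous : ∀ i → ContinuousF (toSphere i)
    toSphere-continuous i =
      comp₂-continuous {_∙_ = _·ᴿ_} {λ t → flatten t i} {λ t → rsqrt ‖ flatten t ‖²} ·-continuous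
        (flatten-continuous i)
        (rsqrt-continuous (λ t → ‖ flatten t ‖²)
          (∑-continuous (λ i t → flatten t i ·ᴿ flatten t i) (λ i →
            comp₂-continuous {_∙_ = _·ᴿ_} {λ t → flatten t i} {λ t → flatten t i} ·-continuous
              (flatten-continuous i) (flatten-continuous i))))

    fromSphere-continuous : ∀ k → ContinuousF (fromSphere k)
    fromSphere-continuous k =
      comp₂-continuous {_∙_ = _·ᴿ_} {λ x → lift x k} {λ x → rsqrt (size x ·ᴿ size x)} ·-continuous
        (lift-continuous k)
        (rsqrt-continuous (λ x → size x ·ᴿ size x)
          (comp₂-continuous {_∙_ = _·ᴿ_} {size} {size} ·-continuous size-continuous size-continuous))

    -- If all three entries were positive, the block would be a set of positive coordinates, hence a
    -- face by the definition of the realization.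
    low₃≅0 : ∀ t → realization K t → ∀ v → low₃ (λ j → t (at v j)) ≅ 0ℝ
    low₃≅0 t (0≤t , _ , faces) v = low₃≅0⁺ (λ j → t (at v j)) (λ j → 0≤t (at v j))
      λ 0<t → block-not-face v (faces (block v) λ {k} k∈ → positive 0<t k (∈block⁻ v k∈))
      where
      positive : (∀ j → 0ℝ <ᴿ t (at v j)) → ∀ k → proj₁ (position k) ≡ v → 0ℝ <ᴿ t k
      positive 0<t k refl = subst (λ k → 0ℝ <ᴿ t k) (at-position k) (0<t (proj₂ (position k)))

    lift-flatten≅ : ∀ t → realization K t → ∀ k → lift (flatten t) k ≅ t k
    lift-flatten≅ t t∈K k = low₃≅0⇒lift-flatten≅ t k (low₃≅0 t t∈K (proj₁ (position k)))

    size-flatten≅1 : ∀ t → realization K t → size (flatten t) ≅ 1ℝ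
    size-flatten≅1 t t∈K = ≅-trans {size (flatten t)} {∑ t} {1ℝ}
      (∑-cong {x = lift (flatten t)} {t} (lift-flatten≅ t t∈K)) (wrap (proj₁ (proj₂ t∈K)))

    toSphere-∈ : ∀ t → realization K t → S^[ d -1] (λ i → toSphere i t)
    toSphere-∈ t t∈K = unwrap (≅-trans {‖ (λ i → toSphere i t) ‖²}
      {rsqrt ‖ flatten t ‖² ·ᴿ rsqrt ‖ flatten t ‖² ·ᴿ ‖ flatten t ‖²} {1ℝ}
      (≡⇒≅ λ l → trans
        (seq-∑-· (λ i → flatten t i ·ᴿ flatten t i) (λ i → toSphere i t ·ᴿ toSphere i t)
          (seq (rsqrt ‖ flatten t ‖²) l · seq (rsqrt ‖ flatten t ‖²) l) l
          (λ i → squares (seq (flatten t i) l) (seq (rsqrt ‖ flatten t ‖²) l)))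
        (ℚ.*-comm (seq ‖ flatten t ‖² l) (seq (rsqrt ‖ flatten t ‖²) l · seq (rsqrt ‖ flatten t ‖²) l)))
      (‖‖²-inverted (flatten t) (size-flatten≅1 t t∈K)))
      where
      squares : ∀ a s → (a · s) · (a · s) ≡ a · a · (s · s)
      squares = solve 2 (λ a s → (a :* s) :* (a :* s) := a :* a :* (s :* s)) refl

    0≤fromSphere : ∀ x k l → 0ℚ ≤ seq (fromSphere k x) l
    0≤fromSphere x k l = 0≤· (0≤lift x k l) (0≤rsqrt (size x ·ᴿ size x) l)

    fromSphere-∈ : ∀ x → S^[ d -1] x → realization K (λ k → fromSphere k x)
    fromSphere-∈ x x∈S =
        (λ k → 0≤⁺ (fromSphere k x) (0≤fromSphere x k))
      , unwrap (≅-trans {∑ (λ k → fromSphere k x)} {rsqrt (size x ·ᴿ size x) ·ᴿ size x} {1ℝ}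
          (≡⇒≅ λ l → trans (seq-∑-· (lift x) (λ k → fromSphere k x) (seq (rsqrt (size x ·ᴿ size x)) l) l (λ _ → refl))
            (ℚ.*-comm (seq (size x) l) (seq (rsqrt (size x ·ᴿ size x)) l)))
          (size-inverted x (wrap x∈S)))
      , (λ σ positive → mk-face σ (λ v ⊆σ → not-all-positive v (λ j → positive (⊆σ j))))
      where
      -- Positivity of the three reals makes all three terms positive at one common late index; yet
      -- at every index one of them is exactly 0.
      not-all-positive : ∀ v → ¬ (∀ j → 0ℝ <ᴿ fromSphere (at v j) x)
      not-all-positive v 0<y = ℚ.<-irrefl refl (subst (0ℚ <_) y≡0 (0<y-at j))
        where
        N = λ j → proj₁ (proj₂ (proj₂ (0<y j)))
        l = N 0F ℕ.⊔ (N 1F ℕ.⊔ N 2F)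
        N≤l : ∀ j → N j ℕ.≤ l
        N≤l 0F = ℕ.m≤m⊔n (N 0F) (N 1F ℕ.⊔ N 2F)
        N≤l 1F = ℕ.≤-trans (ℕ.m≤m⊔n (N 1F) (N 2F)) (ℕ.m≤n⊔m (N 0F) (N 1F ℕ.⊔ N 2F))
        N≤l 2F = ℕ.≤-trans (ℕ.m≤n⊔m (N 1F) (N 2F)) (ℕ.m≤n⊔m (N 0F) (N 1F ℕ.⊔ N 2F))
        0<y-at : ∀ j → 0ℚ < seq (fromSphere (at v j) x) l
        0<y-at j = let ε , 0<ε , _ , gap = 0<y j in
          ℚ.≤-<-trans (≤+ˡ {0ℚ} {0ℚ} ℚ.≤-refl) (ℚ.≤-<-trans (ℚ.+-monoʳ-≤ 0ℚ (ℚ.<⇒≤ 0<ε)) (gap l (N≤l j)))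
        j = proj₁ (lift-vanishes x v l)
        y≡0 : seq (fromSphere (at v j) x) l ≡ 0ℚ
        y≡0 = trans (cong (_· seq (rsqrt (size x ·ᴿ size x)) l) (proj₂ (lift-vanishes x v l)))
                (ℚ.*-zeroˡ (seq (rsqrt (size x ·ᴿ size x)) l))

    fromSphere∘toSphere : ∀ t → realization K t → ∀ k → fromSphere k (λ i → toSphere i t) ≅ t k
    fromSphere∘toSphere t t∈K k = ≅-trans {fromSphere k (λ i → toSphere i t)} {lift (flatten t) k} {t k}
      (rescale-to-polytope (flatten t) (λ i → toSphere i t)
        (rsqrt (size (λ i → toSphere i t) ·ᴿ size (λ i → toSphere i t))) (rsqrt ‖ flatten t ‖²)
        (λ _ _ → refl) (0≤rsqrt ‖ flatten t ‖²) (size-flatten≅1 t t∈K)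
        (size-inverted (λ i → toSphere i t) (wrap (toSphere-∈ t t∈K))) k)
      (lift-flatten≅ t t∈K k)

    toSphere∘fromSphere : ∀ x → S^[ d -1] x → ∀ i → toSphere i (λ k → fromSphere k x) ≅ x i
    toSphere∘fromSphere x x∈S = rescale-to-sphere (flatten (λ k → fromSphere k x)) x
      (rsqrt (size x ·ᴿ size x)) (rsqrt ‖ flatten (λ k → fromSphere k x) ‖²)
      flatten≡ (0≤rsqrt (size x ·ᴿ size x)) (0≤rsqrt ‖ flatten (λ k → fromSphere k x) ‖²) (wrap x∈S)
      (‖‖²-inverted (flatten (λ k → fromSphere k x)) (size-flatten≅1 (λ k → fromSphere k x) (fromSphere-∈ x x∈S)))
      where
      flatten≡ : ∀ i l → seq (flatten (λ k → fromSphere k x) i) l ≡ seq (x i) l · seq (rsqrt (size x ·ᴿ size x)) l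
      flatten≡ i l = trans
        (factor (seq (lift x (at v (inject₁ j))) l) (seq (lift x (at v 2F)) l) (seq (rsqrt (size x ·ᴿ size x)) l))
        (cong (_· seq (rsqrt (size x ·ᴿ size x)) l) (flatten-lift x i l))
        where
        v = proj₁ (remQuot {m} 2 i)
        j = proj₂ (remQuot {m} 2 i)
        factor : ∀ a b r → a · r - b · r ≡ (a - b) · r
        factor = solve 3 (λ a b r → a :* r :- b :* r := (a :- b) :* r) refl

    homeomorphic : realization K ≃ S^[ d -1]
    homeomorphic = homeomorphism⇒≃ (realization K) S^[ d -1]
      toSphere toSphere-continuous toSphere-∈ fromSphere fromSphere-continuous fromSphere-∈
      fromSphere∘toSphere toSphere∘fromSphere

  -- The hypotheses describe a join of `m` triangle boundaries: no block is a face, and every set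
  -- without a full triple is one.
  realization≃sphere :
    (K : SimplicialComplex n) (block : Fin m → Subset n) →
    (∀ v {k} → k ∈ block v → proj₁ (position k) ≡ v) →
    (∀ v → ¬ SimplicialComplex.Face K (block v)) →
    (∀ σ → (∀ v → ¬ (∀ j → at v j ∈ σ)) → SimplicialComplex.Face K σ) →
    realization K ≃ S^[ d -1]
  realization≃sphere K block ∈block⁻ block-not-face mk-face =
    Homeomorphism.homeomorphic K block ∈block⁻ block-not-face mk-face
      (RSqrt.rsqrt E κ 0<κ κ≤1 1≤E Eκ≡1) (RSqrt.rsqrt-continuous E κ 0<κ κ≤1 1≤E Eκ≡1)
      (RSqrt.0≤rsqrt E κ 0<κ κ≤1 1≤E Eκ≡1) (RSqrt.rsqrt-inverts E κ 0<κ κ≤1 1≤E Eκ≡1)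

-- Enumerating a subset of Fin n

select : ∀ {n} (p : Subset n) → Fin (card p) → Fin n
select (inside  ∷ p) zero    = zero
select (inside  ∷ p) (suc i) = suc (select p i)
select (outside ∷ p) i       = suc (select p i)

select-∈ : ∀ {n} (p : Subset n) i → select p i ∈ p
select-∈ (inside  ∷ p) zero    = here
select-∈ (inside  ∷ p) (suc i) = there (select-∈ p i)
select-∈ (outside ∷ p) i       = there (select-∈ p i)

select-injective : ∀ {n} (p : Subset n) {i j} → select p i ≡ select p j → i ≡ j
select-injective (inside  ∷ p) {zero}  {zero}  _  = refl
select-injective (inside  ∷ p) {suc i} {suc j} eq = cong suc (select-injective p (suc-injective eq))
select-injective (outside ∷ p) eq = select-injective p (suc-injective eq)

rank : ∀ {n} (p : Subset n) {x} → x ∈ p → Fin (card p)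
rank (inside  ∷ p) here       = zero
rank (inside  ∷ p) (there x∈) = suc (rank p x∈)
rank (outside ∷ p) (there x∈) = rank p x∈

select-rank : ∀ {n} (p : Subset n) {x} (x∈ : x ∈ p) → select p (rank p x∈) ≡ x
select-rank (inside  ∷ p) here       = refl
select-rank (inside  ∷ p) (there x∈) = cong suc (select-rank p x∈)
select-rank (outside ∷ p) (there x∈) = cong suc (select-rank p x∈)

rank-select : ∀ {n} (p : Subset n) {x i} (x∈ : x ∈ p) → x ≡ select p i → rank p x∈ ≡ i
rank-select p x∈ eq = select-injective p (trans (select-rank p x∈) eq)

-- Degrees in an edge set are bounded by injections into `Fin k`, which avoids computing
-- intersections.
card≤ : ∀ {n k} (p : Subset n) (g : ∀ x → x ∈ p → Fin k) →
        (∀ x y x∈ y∈ → g x x∈ ≡ g y y∈ → x ≡ y) → card p ℕ.≤ k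
card≤ p g g-injective = injective⇒≤ {f = λ i → g (select p i) (select-∈ p i)}
  λ eq → select-injective p (g-injective _ _ _ _ eq)

≤card : ∀ {n k} (p : Subset n) (f : Fin k → Fin n) → (∀ i → f i ∈ p) →
        (∀ {i j} → f i ≡ f j → i ≡ j) → k ℕ.≤ card p
≤card p f f∈ f-injective = injective⇒≤ {f = λ i → rank p (f∈ i)} λ {i} {j} eq →
  f-injective (trans (sym (select-rank p (f∈ i))) (trans (cong (select p) eq) (select-rank p (f∈ j))))

-- Finite types and the edges at a vertex

module _ {A : Set} (A-finite : Finite A) where
  open Finite A-finite

  index-element : ∀ i → index (element i) ≡ i
  index-element = Inverse.strictlyInverseˡ enum

  element-index : ∀ a → element (index a) ≡ a
  element-index = Inverse.strictlyInverseʳ enum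

  element-injective : ∀ {i j} → element i ≡ element j → i ≡ j
  element-injective {i} {j} eq = trans (sym (index-element i)) (trans (cong index eq) (index-element j))

module _ (H : Graph) where
  open Graph H

  ∈edgesAt⁻ : ∀ v {i} → i ∈ edgesAt v → Incident v (Finite.element E-finite i)
  ∈edgesAt⁻ v {i} i∈ = witness (incident? v (Finite.element E-finite i))
    (trans (sym (lookup∘tabulate (λ i → does (incident? v (Finite.element E-finite i))) i)) ([]=⇒lookup i∈))
    where
    witness : ∀ {A : Set} (a? : Dec A) → does a? ≡ true → A
    witness (yes a) _  = a
    witness (no _)  ()

  ∈edgesAt⁺ : ∀ v {i} → Incident v (Finite.element E-finite i) → i ∈ edgesAt v
  ∈edgesAt⁺ v {i} inc = lookup⇒[]= i (edgesAt v)
    (trans (lookup∘tabulate (λ i → does (incident? v (Finite.element E-finite i))) i)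
           (dec-true (incident? v (Finite.element E-finite i)) inc))

-- The claws of the clawed graph

module Claws (G : Graph) (degree≤3 : MaxDegreeAtMost 3 G) where
  open Graph G
  open Clawed G using (CE; CV; end; Leaf)

  C : Graph
  C = clawedGraph G

  open Finite E-finite using () renaming (index to E-index; element to E-element)
  open Finite V-finite using () renaming (size to m; index to V-index; element to V-element)
  open Finite (Graph.E-finite C) using () renaming (size to n; index to C-index; element to C-element)

  end-injective : ∀ e s t → end e s ≡ end e t → s ≡ t
  end-injective e zero       zero       _  = refl
  end-injective e zero       (suc zero) eq = ⊥-elim (loopless e eq)
  end-injective e (suc zero) zero       eq = ⊥-elim (loopless e (sym eq))
  end-injective e (suc zero) (suc zero) _  = refl

  incident-end : ∀ e s → Incident (end e s) e
  incident-end e zero       = inj₁ refl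
  incident-end e (suc zero) = inj₂ refl

  side : ∀ {v e} → Incident v e → ∃[ s ] end e s ≡ v
  side (inj₁ eq) = zero , sym eq
  side (inj₂ eq) = suc zero , sym eq

  -- First the halves of the edges of G at v, then the pendants.
  ClawEdge : V → Set
  ClawEdge v = Fin (degree v) ⊎ Fin (3 ∸ degree v)

  selected : ∀ v q → Incident v (E-element (select (edgesAt v) q))
  selected v q = ∈edgesAt⁻ G v (select-∈ (edgesAt v) q)

  end-∈ : ∀ e s → E-index e ∈ edgesAt (end e s)
  end-∈ e s = ∈edgesAt⁺ G (end e s) (subst (Incident (end e s)) (sym (element-index E-finite e)) (incident-end e s))

  -- Every edge of `CG` has exactly one original end, and it belongs to the claw of that end.
  toClaw : CE → Σ V ClawEdge
  toClaw (inj₁ (e , s)) = end e s , inj₁ (rank (edgesAt (end e s)) (end-∈ e s))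
  toClaw (inj₂ (v , l)) = v , inj₂ l

  fromClaw : Σ V ClawEdge → CE
  fromClaw (v , inj₁ q) = inj₁ (E-element (select (edgesAt v) q) , proj₁ (side (selected v q)))
  fromClaw (v , inj₂ l) = inj₂ (v , l)

  toClaw-fromClaw : ∀ c → toClaw (fromClaw c) ≡ c
  toClaw-fromClaw (v , inj₂ l) = refl
  toClaw-fromClaw (v , inj₁ q) = transport (proj₂ (side (selected v q)))
    (end-∈ (E-element (select (edgesAt v) q)) (proj₁ (side (selected v q))))
    where
    -- The end chosen by `side` equals `v` only propositionally; generalising over it and over the
    -- membership proof lets the equation be matched.
    transport : ∀ {w} → w ≡ v → (r : E-index (E-element (select (edgesAt v) q)) ∈ edgesAt w) →
                _≡_ {A = Σ V ClawEdge} (w , inj₁ (rank (edgesAt w) r)) (v , inj₁ q)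
    transport refl r = cong (λ q → v , inj₁ q)
      (rank-select (edgesAt v) r (index-element E-finite (select (edgesAt v) q)))

  fromClaw-toClaw : ∀ c → fromClaw (toClaw c) ≡ c
  fromClaw-toClaw (inj₂ (v , l)) = refl
  fromClaw-toClaw (inj₁ (e , s)) = same-half
    (trans (cong E-element (select-rank (edgesAt (end e s)) (end-∈ e s))) (element-index E-finite e))
    (proj₂ (side (selected (end e s) (rank (edgesAt (end e s)) (end-∈ e s)))))
    where
    same-half : ∀ {f t} → f ≡ e → end f t ≡ end e s → _≡_ {A = CE} (inj₁ (f , t)) (inj₁ (e , s))
    same-half refl eq = cong (λ s → inj₁ (e , s)) (end-injective e _ _ eq)

  -- The degree bound enters here: it makes the truncated subtraction exact, so that halves and
  -- pendants together number 3.
  claw↔3 : ∀ v → ClawEdge v ↔ Fin 3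
  claw↔3 v = subst (λ k → ClawEdge v ↔ Fin k) (ℕ.m+[n∸m]≡n (degree≤3 v)) (↔-sym +↔⊎)

  β : Fin n ↔ (Fin m × Fin 3)
  β = (Finite.enum V-finite ×-↔ ↔-id (Fin 3)) ↔-∘ (Σ-Fun.cong (↔-id V) (λ {v} → claw↔3 v)
      ↔-∘ (mk↔ₛ′ toClaw fromClaw toClaw-fromClaw fromClaw-toClaw ↔-∘ ↔-sym (Finite.enum (Graph.E-finite C))))

  open Inverse β using () renaming (to to position; from to at)

  origin : CE → V
  origin c = proj₁ (toClaw c)

  incident-original : ∀ {v} c → Graph.Incident C (inj₁ v) c → origin c ≡ v
  incident-original (inj₁ _) (inj₁ refl) = refl
  incident-original (inj₂ _) (inj₁ refl) = refl

  original-incident : ∀ c → Graph.Incident C (inj₁ (origin c)) c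
  original-incident (inj₁ _) = inj₁ refl
  original-incident (inj₂ _) = inj₁ refl

  incident-midpoint : ∀ {e} c → Graph.Incident C (inj₂ (inj₁ e)) c → ∃[ s ] c ≡ inj₁ (e , s)
  incident-midpoint (inj₁ _)       (inj₁ ())
  incident-midpoint (inj₁ (e , s)) (inj₂ refl) = s , refl
  incident-midpoint (inj₂ _)       (inj₁ ())
  incident-midpoint (inj₂ _)       (inj₂ ())

  incident-leaf : ∀ {l} c → Graph.Incident C (inj₂ (inj₂ l)) c → c ≡ inj₂ l
  incident-leaf (inj₁ _) (inj₁ ())
  incident-leaf (inj₁ _) (inj₂ ())
  incident-leaf (inj₂ _) (inj₁ ())
  incident-leaf (inj₂ l) (inj₂ refl) = refl

  block : Fin m → Subset n
  block v = Graph.edgesAt C (inj₁ (V-element v))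

  ∈block⁻ : ∀ v {k} → k ∈ block v → proj₁ (position k) ≡ v
  ∈block⁻ v {k} k∈ = trans (cong V-index (incident-original (C-element k) (∈edgesAt⁻ C (inj₁ (V-element v)) k∈)))
    (index-element V-finite v)

  at-∈block : ∀ v j → at (v , j) ∈ block v
  at-∈block v j = ∈edgesAt⁺ C (inj₁ (V-element v))
    (subst (λ w → Graph.Incident C (inj₁ w) (C-element (at (v , j)))) origin≡
      (original-incident (C-element (at (v , j)))))
    where
    origin≡ : origin (C-element (at (v , j))) ≡ V-element v
    origin≡ = trans (sym (element-index V-finite _))
      (cong V-element (cong proj₁ (Inverse.strictlyInverseˡ β (v , j))))

  -- The matching condition fails at the original vertex itself, where the three places of its claw
  -- give three distinct edges.
  block-not-face : ∀ v → ¬ SimplicialComplex.Face (M₂ C) (block v)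
  block-not-face v face = ℕ.<⇒≱ {2} {3} ℕ.≤-refl (ℕ.≤-trans
    (≤card (block v ∩ block v) (λ j → at (v , j)) (λ j → x∈p∩q⁺ (at-∈block v j , at-∈block v j))
      (λ {i} {j} eq → cong proj₂ (trans (sym (Inverse.strictlyInverseˡ β (v , i)))
        (trans (cong position eq) (Inverse.strictlyInverseˡ β (v , j))))))
    (face (inj₁ (V-element v))))

  -- At an original vertex a finite search turns the negation into a missing claw edge, and punching
  -- out its place embeds the others into `Fin 2`. Midpoints have only two edges and leaves only
  -- one.
  mk-face : ∀ σ → (∀ v → ¬ (∀ j → at (v , j) ∈ σ)) → SimplicialComplex.Face (M₂ C) σ
  mk-face σ not-all (inj₁ w) = card≤ (σ ∩ Graph.edgesAt C (inj₁ w))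
    (λ x x∈ → punchOut (j≢ x x∈))
    (λ x y x∈ y∈ eq → trans (sym (Inverse.strictlyInverseʳ β x)) (trans
      (cong at (cong₂ _,_ (trans (owner x x∈) (sym (owner y y∈)))
        (punchOut-injective (j≢ x x∈) (j≢ y y∈) eq)))
      (Inverse.strictlyInverseʳ β y)))
    where
    v = V-index w
    missing : ∃[ j ] ¬ (at (v , j) ∈ σ)
    missing = ¬∀⟶∃¬ 3 (λ j → at (v , j) ∈ σ) (λ j → at (v , j) ∈? σ) (not-all v)
    owner : ∀ x → x ∈ σ ∩ Graph.edgesAt C (inj₁ w) → proj₁ (position x) ≡ v
    owner x x∈ = cong V-index (incident-original (C-element x)
      (∈edgesAt⁻ C (inj₁ w) (proj₂ (x∈p∩q⁻ σ (Graph.edgesAt C (inj₁ w)) x∈))))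
    j≢ : ∀ x → x ∈ σ ∩ Graph.edgesAt C (inj₁ w) → proj₁ missing ≢ proj₂ (position x)
    j≢ x x∈ eq = proj₂ missing (subst (_∈ σ)
      (trans (sym (Inverse.strictlyInverseʳ β x)) (cong at (cong₂ _,_ (owner x x∈) (sym eq))))
      (proj₁ (x∈p∩q⁻ σ (Graph.edgesAt C (inj₁ w)) x∈)))
  mk-face σ _ w@(inj₂ (inj₁ e)) = card≤ (σ ∩ Graph.edgesAt C w)
    (λ x x∈ → proj₁ (half-of x x∈))
    (λ x y x∈ y∈ eq → element-injective (Graph.E-finite C) (trans (proj₂ (half-of x x∈))
      (trans (cong (λ s → inj₁ (e , s)) eq) (sym (proj₂ (half-of y y∈))))))
    where
    half-of : ∀ x → x ∈ σ ∩ Graph.edgesAt C w → ∃[ s ] C-element x ≡ inj₁ (e , s)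
    half-of x x∈ = incident-midpoint (C-element x) (∈edgesAt⁻ C w (proj₂ (x∈p∩q⁻ σ (Graph.edgesAt C w) x∈)))
  mk-face σ _ w@(inj₂ (inj₂ l)) = ℕ.≤-trans (card≤ {k = 1} (σ ∩ Graph.edgesAt C w)
    (λ _ _ → zero) (λ x y x∈ y∈ _ → element-injective (Graph.E-finite C)
      (trans (pendant-of x x∈) (sym (pendant-of y y∈)))))
    (s≤s z≤n)
    where
    pendant-of : ∀ x → x ∈ σ ∩ Graph.edgesAt C w → C-element x ≡ inj₂ l
    pendant-of x x∈ = incident-leaf (C-element x) (∈edgesAt⁻ C w (proj₂ (x∈p∩q⁻ σ (Graph.edgesAt C w) x∈)))

  n≡3m : n ≡ m ℕ.* 3
  n≡3m = ↔⇒≡ (↔-sym *↔× ↔-∘ β)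

mainTheorem4 : (G : Graph) → MaxDegreeAtMost 3 G →
    ∃[ d ] 3 * d ≡ 2 * Graph.∣E∣ (clawedGraph G) × (realization (M₂ (clawedGraph G)) ≃ S^[ d -1])
-- One plane for each of the `m` original vertices; as there are 3m edges, the ambient dimension 2m
-- is two thirds of their number.
mainTheorem4 G degree≤3 = m * 2 , 3d≡2n ,
  Join.realization≃sphere β (M₂ C) block ∈block⁻ block-not-face mk-face
  where
  open Claws G degree≤3
  m = Finite.size (Graph.V-finite G)
  open ≡-Reasoning
  3d≡2n : 3 * (m * 2) ≡ 2 * Graph.∣E∣ (clawedGraph G)
  3d≡2n = begin
    3 * (m * 2)                       ≡⟨ ℕ.*-comm 3 (m * 2) ⟩
    m * 2 * 3                         ≡⟨ ℕ.*-assoc m 2 3 ⟩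
    m * (3 * 2)                       ≡⟨ ℕ.*-assoc m 3 2 ⟨
    m * 3 * 2                         ≡⟨ ℕ.*-comm (m * 3) 2 ⟩
    2 * (m * 3)                       ≡⟨ cong (2 *_) n≡3m ⟨
    2 * Graph.∣E∣ (clawedGraph G)     ∎
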